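{- Let $n\ge 1$ and let $\lambda$ be a partition with at most $n$ nonzero parts. The map $$\Omega:=\psi_{\mathrm{inv}}^{ -1}\circ\psi_{\mathrm{quinv}}=\psi_{\mathrm{inv}}^{ -1}\circ\mathrm{boxcomp}\circ\psi_{\mathrm{inv}}:\ \mathrm{CSF}(\lambda)\to\mathrm{CSF}(\lambda)$$ is an involution satisfying $\mathrm{inv}(\Omega(F))=\mathrm{quinv}(F)$ for all $F\in\mathrm{CSF}(\lambda)$. Further, $\mathrm{rsort}(F)=\mathrm{rsort}(\Omega(F))$ for all $F\in\mathrm{CSF}(\lambda)$.
   Context: The Young diagram of $\lambda$ is $\mathrm{dg}(\lambda)=\{(r,c):1\le c\le\lambda_r\}$, with $r$ the row index from the top and $c$ the column index from the left. $\mathrm{CSF}(\lambda)$ is the set of column strict fillings: maps $F:\mathrm{dg}(\lambda)\to[n]=\{1,\dots,n\}$ strictly increasing down each column. Statistics. For a cell $u=(i,j)$ with $i>1$ let $u^\uparrow=(i-1,j)$; $\mathrm{Des}(F)$ is the set of cells $u$ not in the first row with $F(u)>F(u^\uparrow)$; $\mathrm{arm}(u)$ is the number of cells of $\mathrm{dg}(\lambda)$ strictly to the right of $u$ in its row. A cell $u$ Inv-attacks $v$ if they are in the same row with $u$ strictly left of $v$, or $u$ is in the row immediately below that of $v$, in a column strictly to the right of that of $v$. A cell $u$ Quinv-attacks $v$ if they are in the same row with $u$ strictly right of $v$, or $u$ is in the row immediately below that of $v$, in a column strictly to the left of that of $v$. $\mathrm{Inv}(F)$ (resp. $\mathrm{Quinv}(F)$)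 is the set of pairs $(u,v)$ such that $u$ Inv-attacks (resp. Quinv-attacks) $v$ and $F(u)>F(v)$. Then $\mathrm{inv}(F)=|\mathrm{Inv}(F)|-\sum_{u\in\mathrm{Des}(F)}\mathrm{arm}(u)$ and $\mathrm{quinv}(F)=|\mathrm{Quinv}(F)|-\sum_{u\in\mathrm{Des}(F)}\mathrm{arm}(u^\uparrow)$. Patterns. $\mathrm{GT}(\lambda)$ is the set of integer arrays $T=(T^j_i:1\le i\le j\le n)$ with $T^n_i=\lambda_i$ and, for $1\le i\le j<n$, $\mathrm{NE}_{ij}(T):=T^{j+1}_i-T^j_i\ge0$ and $\mathrm{SE}_{ij}(T):=T^j_i-T^{j+1}_{i+1}\ge0$; it is identified with semistandard Young tableaux of shape $\lambda$ with entries in $[n]$ by letting $T^j_i$ be the number of cells in row $i$ with entries $\le j$. $\mathrm{rsort}(F)$ is obtained from $F$ by sorting the entries of each row in ascending order from left to right; it is a semistandard tableau, regarded as an element of $\mathrm{GT}(\lambda)$. $\mathrm{POP}(\lambda)$ is the set of pairs $(T,\Lambda)$ with $T\in\mathrm{GT}(\lambda)$ and $\Lambda=(\Lambda_{ij}:1\le i\le j<n)$ a tuple of partitions, $\Lambda_{ij}$ having at most $\mathrm{NE}_{ij}(T)$ nonzero parts, each $\le\mathrm{SE}_{ij}(T)$. $\mathrm{boxcomp}(T,\Lambda)=(T,\Lambda^c)$, where $(\Lambda^c)_{ij}$ is the complement of $\Lambda_{ij}$ in its $k\times\ell=\mathrm{NE}_{ij}(T)\times\mathrm{SE}_{ij}(T)$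 rectangle; the complement of $(\pi_1\ge\dots\ge\pi_k\ge0)$ is $(\ell-\pi_k\ge\dots\ge\ell-\pi_1)$. The maps $\psi_v$. For $F\in\mathrm{CSF}(\lambda)$ and a cell $c\in\mathrm{dg}(\lambda)$, let $\mathrm{zcount}(c,F)$ (resp. $\overline{\mathrm{zcount}}(c,F)$) be the number of cells $x$ in the row of $c$, strictly to the left (resp. strictly to the right) of $c$, such that $F(x)<F(c)<F(y)$, where $y$ is the position immediately below $x$ and $F(y):=\infty$ if $y\notin\mathrm{dg}(\lambda)$. For $1\le i\le j<n$ let $\mathrm{cells}(i,j,F)$ be the set of cells $c$ in row $i$ with $F(c)=j+1$. Put $T=\mathrm{rsort}(F)$. Let $\Lambda_{ij}$ be the sequence of $\mathrm{zcount}(c,F)$, $c\in\mathrm{cells}(i,j,F)$, read from right to left in row $i$, and $\overline\Lambda_{ij}$ the sequence of $\overline{\mathrm{zcount}}(c,F)$, $c\in\mathrm{cells}(i,j,F)$, read from left to right. These are partitions fitting in the $\mathrm{NE}_{ij}(T)\times\mathrm{SE}_{ij}(T)$ rectangle, and one defines $\psi_{\mathrm{quinv}}(F)=(T,(\Lambda_{ij}))$ and $\psi_{\mathrm{inv}}(F)=(T,(\overline\Lambda_{ij}))$. Both are bijections $\mathrm{CSF}(\lambda)\to\mathrm{POP}(\lambda)$. -}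

module Defs where

open import Data.Fin.Base as Fin using (Fin; toℕ; inject≤)
import Data.Fin.Properties as Fin
open import Data.Integer.Base using (ℤ; _⊖_)
open import Data.List.Base
  using (List; []; _∷_; [_]; _++_; length; map; filter; reverse; upTo; concatMap; tabulate; cartesianProduct)
open import Data.List.Properties
  using (length-map; length-reverse; length-tabulate; length-filter; filter-all; unfold-reverse)
open import Data.List.Relation.Binary.Permutation.Propositional using (_↭_)
open import Data.List.Relation.Binary.Permutation.Propositional.Properties using (↭-length; filter-↭)
open import Data.List.Relation.Unary.All as All using (All; []; _∷_)
import Data.List.Relation.Unary.All.Properties as All
open import Data.List.Relation.Unary.AllPairs as AllPairs using (AllPairs; []; _∷_)
import Data.List.Relation.Unary.AllPairs.Properties as AllPairs
open import Data.List.Relation.Unary.Linked using (Linked)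
import Data.List.Relation.Unary.Linked.Properties as Linked
import Data.List.Sort as Sort
open import Data.Maybe.Base using (Maybe; just; nothing; maybe′)
import Data.Maybe.Relation.Unary.All as Maybe
import Data.Maybe.Relation.Unary.Any as MaybeAny
open import Data.Nat.Base
open import Data.Nat.ListAction using (sum)
open import Data.Nat.Properties
open import Data.Product.Base using (_×_; _,_; proj₁; proj₂)
open import Data.Sum.Base using (_⊎_; inj₁; inj₂)
open import Function.Base using (_∘_; id)
open import Relation.Binary.PropositionalEquality
  using (_≡_; refl; sym; trans; cong; cong₂; subst; subst₂)
open import Relation.Nullary.Decidable using (Dec; yes; no; recompute; _×-dec_; _⊎-dec_)
open import Relation.Nullary.Negation using (¬_; contradiction)
open import Relation.Unary using (Decidable)

-- Everything is indexed from 0: rows, columns, the alphabet [n] (here Fin n)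
-- and both indices of a pattern.  Row i, entry a and index j here are row
-- i + 1, entry a + 1 and index j + 1 in the 1-based convention, so that
-- conditions such as "F(c) = j + 1" or "entries ≤ j" look the same in both.

record Partition (n : ℕ) : Set where
  field
    part       : ℕ → ℕ
    decreasing : ∀ i → part (suc i) ≤ part i
    finite     : ∀ i → n ≤ i → part i ≡ 0

open Partition public

record Cell {n : ℕ} (lam : Partition n) : Set where
  constructor cell
  field
    row col : ℕ
    .inside : col < part lam row

open Cell public

module _ {n : ℕ} {lam : Partition n} where

  up : Cell lam → Maybe (Cell lam)
  up (cell zero    c p) = nothing
  up (cell (suc r) c p) = just (cell r c (<-≤-trans p (decreasing lam r)))

  below : Cell lam → Maybe (Cell lam)
  below (cell r c p) with c <? part lam (suc r)
  ... | yes q = just (cell (suc r) c q)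
  ... | no  _ = nothing

module _ {n : ℕ} (lam : Partition n) where

  rowCell : (r : ℕ) → Fin (part lam r) → Cell lam
  rowCell r k = cell r (toℕ k) (Fin.toℕ<n k)

  rowCells : ℕ → List (Cell lam)
  rowCells r = tabulate (rowCell r)

  cells : List (Cell lam)
  cells = concatMap rowCells (upTo n)

  record CSF : Set where
    field
      entry  : Cell lam → Fin n
      strict : ∀ u v → col u ≡ col v → row u < row v → entry u Fin.< entry v

  open CSF public

module _ {n : ℕ} {lam : Partition n} where

  infix 4 _≈_

  _≈_ : CSF lam → CSF lam → Set
  F ≈ G = ∀ u → entry F u ≡ entry G u

module _ {n : ℕ} {lam : Partition n} where

  arm : Cell lam → ℕ
  arm u = length (filter (λ x → col u <? col x) (rowCells lam (row u)))

  InvAttacks : Cell lam → Cell lam → Set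
  InvAttacks u v = (row u ≡ row v × col u < col v)
                 ⊎ (row u ≡ suc (row v) × col v < col u)

  QuinvAttacks : Cell lam → Cell lam → Set
  QuinvAttacks u v = (row u ≡ row v × col v < col u)
                   ⊎ (row u ≡ suc (row v) × col u < col v)

  invAttacks? : ∀ u v → Dec (InvAttacks u v)
  invAttacks? u v = (row u ≟ row v ×-dec col u <? col v)
              ⊎-dec (row u ≟ suc (row v) ×-dec col v <? col u)

  quinvAttacks? : ∀ u v → Dec (QuinvAttacks u v)
  quinvAttacks? u v = (row u ≟ row v ×-dec col v <? col u)
                ⊎-dec (row u ≟ suc (row v) ×-dec col u <? col v)

  module _ (F : CSF lam) where

    private
      f = entry F

    Inv : List (Cell lam × Cell lam)
    Inv = filter (λ (u , v) → invAttacks? u v ×-dec f v Fin.<? f u)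
                 (cartesianProduct (cells lam) (cells lam))

    Quinv : List (Cell lam × Cell lam)
    Quinv = filter (λ (u , v) → quinvAttacks? u v ×-dec f v Fin.<? f u)
                   (cartesianProduct (cells lam) (cells lam))

    -- MaybeAny.Any is false at nothing, so cells of the first row are excluded.
    Des : List (Cell lam)
    Des = filter (λ u → MaybeAny.dec (λ v → f v Fin.<? f u) (up u)) (cells lam)

    inv : ℤ
    inv = length Inv ⊖ sum (map arm Des)

    -- Cells of Des are never in the first row, so the default 0 is not used.
    quinv : ℤ
    quinv = length Quinv ⊖ sum (map (maybe′ arm 0 ∘ up) Des)

-- T i j is T^j_i.  Entries in ℕ lose nothing: the SE inequalities and the
-- last row force T^j_i ≥ λ_(i+n-j) ≥ 0.
Array : ℕ → Set
Array n = (i j : ℕ) → .(i ≤ j) → .(j < n) → ℕ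

module _ {n : ℕ} (T : Array n) (i j : ℕ) .(i≤j : i ≤ j) .(1+j<n : suc j < n) where

  private
    T[i,j] T[i,1+j] T[1+i,1+j] : ℕ
    T[i,j]     = T i j i≤j (<-trans (n<1+n j) 1+j<n)
    T[i,1+j]   = T i (suc j) (m≤n⇒m≤1+n i≤j) 1+j<n
    T[1+i,1+j] = T (suc i) (suc j) (s≤s i≤j) 1+j<n

  -- The truncated subtractions in NE and SE are exact under these.
  NE-nonneg SE-nonneg : Set
  NE-nonneg = T[i,j] ≤ T[i,1+j]
  SE-nonneg = T[1+i,1+j] ≤ T[i,j]

  NE SE : ℕ
  NE = T[i,1+j] ∸ T[i,j]
  SE = T[i,j] ∸ T[1+i,1+j]

record GT {n : ℕ} (lam : Partition n) : Set where
  field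
    array : Array n
    top   : ∀ i j (i≤j : i ≤ j) (j<n : j < n) → suc j ≡ n → array i j i≤j j<n ≡ part lam i
    NE≥0  : ∀ i j (i≤j : i ≤ j) (1+j<n : suc j < n) → NE-nonneg array i j i≤j 1+j<n
    SE≥0  : ∀ i j (i≤j : i ≤ j) (1+j<n : suc j < n) → SE-nonneg array i j i≤j 1+j<n

open GT public

-- A partition with at most k nonzero parts, each ≤ ℓ, is written out as a
-- weakly decreasing sequence of exactly k parts, zeros included.
record InBox (k ℓ : ℕ) (π : List ℕ) : Set where
  field
    length≡ : length π ≡ k
    sorted  : Linked _≥_ π
    bounded : All (_≤ ℓ) π

open InBox public

complement : ℕ → List ℕ → List ℕ
complement ℓ π = reverse (map (ℓ ∸_) π)

record POP {n : ℕ} (lam : Partition n) : Set where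
  field
    pattern′ : GT lam
    overlay  : (i j : ℕ) → .(i ≤ j) → .(suc j < n) → List ℕ
    inBox    : ∀ i j (i≤j : i ≤ j) (1+j<n : suc j < n) →
               InBox (NE (array pattern′) i j i≤j 1+j<n)
                     (SE (array pattern′) i j i≤j 1+j<n)
                     (overlay i j i≤j 1+j<n)

open POP public

module _ {n : ℕ} {lam : Partition n} where

  infix 4 _≈ᴳ_ _≈ᴾ_

  _≈ᴳ_ : GT lam → GT lam → Set
  S ≈ᴳ T = ∀ i j (i≤j : i ≤ j) (j<n : j < n) → array S i j i≤j j<n ≡ array T i j i≤j j<n

  _≈ᴾ_ : POP lam → POP lam → Set
  P ≈ᴾ Q = pattern′ P ≈ᴳ pattern′ Q
         × (∀ i j (i≤j : i ≤ j) (1+j<n : suc j < n) →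
            overlay P i j i≤j 1+j<n ≡ overlay Q i j i≤j 1+j<n)

private
  module _ {A : Set} where

    count : {P : A → Set} → Decidable P → List A → ℕ
    count P? xs = length (filter P? xs)

    count-mono : {P Q : A → Set} (P? : Decidable P) (Q? : Decidable Q) →
                 (∀ x → P x → Q x) → ∀ xs → count P? xs ≤ count Q? xs
    count-mono P? Q? f [] = z≤n
    count-mono P? Q? f (x ∷ xs) with P? x | Q? x
    ... | yes p | yes q = s≤s (count-mono P? Q? f xs)
    ... | yes p | no ¬q = contradiction (f x p) ¬q
    ... | no ¬p | yes q = m≤n⇒m≤1+n (count-mono P? Q? f xs)
    ... | no ¬p | no ¬q = count-mono P? Q? f xs

    count-split : {P Q R : A → Set} (P? : Decidable P) (Q? : Decidable Q) (R? : Decidable R) →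
                  (∀ x → P x → R x) → (∀ x → Q x → R x) → (∀ x → R x → P x ⊎ Q x) →
                  (∀ x → P x → ¬ Q x) → ∀ xs → count R? xs ≡ count P? xs + count Q? xs
    count-split P? Q? R? f g h d [] = refl
    count-split P? Q? R? f g h d (x ∷ xs)
      with P? x | Q? x | R? x | count-split P? Q? R? f g h d xs
    ... | yes p | yes q | _     | _  = contradiction q (d x p)
    ... | yes p | no _  | yes _ | ih = cong suc ih
    ... | yes p | no _  | no ¬r | _  = contradiction (f x p) ¬r
    ... | no _  | yes q | yes _ | ih = trans (cong suc ih) (sym (+-suc _ _))
    ... | no _  | yes q | no ¬r | _  = contradiction (g x q) ¬r
    ... | no ¬p | no ¬q | yes r | _  with h x r
    ...   | inj₁ p = contradiction p ¬p
    ...   | inj₂ q = contradiction q ¬q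
    count-split P? Q? R? f g h d (x ∷ xs) | no _ | no _ | no _ | ih = ih

    count-tabulate : {P Q R : A → Set} (P? : Decidable P) (Q? : Decidable Q) (R? : Decidable R) →
                     ∀ {l m} (l≤m : l ≤ m) (f : Fin l → A) (g : Fin m → A) →
                     (∀ k → P (g k) → R (g k)) →
                     (∀ k → Q (f k) → R (g (inject≤ k l≤m))) →
                     (∀ k → Q (f k) → ¬ P (g (inject≤ k l≤m))) →
                     count P? (tabulate g) + count Q? (tabulate f) ≤ count R? (tabulate g)
    count-tabulate P? Q? R? {m = zero} z≤n f g pr qr qp = z≤n
    count-tabulate P? Q? R? {m = suc m} z≤n f g pr qr qp
      with P? (g Fin.zero) | R? (g Fin.zero)
         | count-tabulate P? Q? R? {m = m} z≤n f (g ∘ Fin.suc) (pr ∘ Fin.suc) (λ ()) (λ ())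
    ... | yes p | yes _ | ih = s≤s ih
    ... | yes p | no ¬r | _  = contradiction (pr Fin.zero p) ¬r
    ... | no _  | yes _ | ih = m≤n⇒m≤1+n ih
    ... | no _  | no _  | ih = ih
    count-tabulate P? Q? R? (s≤s l≤m) f g pr qr qp
      with P? (g Fin.zero) | Q? (f Fin.zero) | R? (g Fin.zero)
         | count-tabulate P? Q? R? l≤m (f ∘ Fin.suc) (g ∘ Fin.suc)
             (pr ∘ Fin.suc) (qr ∘ Fin.suc) (qp ∘ Fin.suc)
    ... | yes p | yes q | _     | _  = contradiction p (qp Fin.zero q)
    ... | yes p | no _  | yes _ | ih = s≤s ih
    ... | yes p | no _  | no ¬r | _  = contradiction (pr Fin.zero p) ¬r
    ... | no _  | yes q | yes _ | ih = ≤-trans (≤-reflexive (+-suc _ _)) (s≤s ih)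
    ... | no _  | yes q | no ¬r | _  = contradiction (qr Fin.zero q) ¬r
    ... | no _  | no _  | yes _ | ih = m≤n⇒m≤1+n ih
    ... | no _  | no _  | no _  | ih = ih

    All-reverse : {P : A → Set} {xs : List A} → All P xs → All P (reverse xs)
    All-reverse [] = []
    All-reverse {xs = x ∷ xs} (p ∷ ps) =
      subst (All _) (sym (unfold-reverse x xs)) (All.++⁺ (All-reverse ps) (p ∷ []))

    AllPairs-reverse : {R : A → A → Set} {xs : List A} →
                       AllPairs R xs → AllPairs (λ x y → R y x) (reverse xs)
    AllPairs-reverse [] = []
    AllPairs-reverse {R} {x ∷ xs} (px ∷ pxs) =
      subst (AllPairs _) (sym (unfold-reverse x xs))
        (AllPairs.++⁺ (AllPairs-reverse pxs) ([] ∷ [])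
          (All.map (_∷ []) (All-reverse px)))

    count-map : {B : Set} {P : B → Set} (P? : Decidable P) (f : A → B) (xs : List A) →
                length (filter P? (map f xs)) ≡ count (λ x → P? (f x)) xs
    count-map P? f [] = refl
    count-map P? f (x ∷ xs) with P? (f x)
    ... | yes _ = cong suc (count-map P? f xs)
    ... | no  _ = count-map P? f xs

    AllPairs-map : {B : Set} {R : A → A → Set} {S : B → B → Set} {P : A → Set} (f : A → B) →
                   (∀ {x y} → P x → P y → R x y → S (f x) (f y)) →
                   ∀ {xs} → All P xs → AllPairs R xs → AllPairs S (map f xs)
    AllPairs-map f h [] [] = []
    AllPairs-map f h (p ∷ ps) (r ∷ rs) =
      All.map⁺ (All.zipWith (λ (q , s) → h p q s) (ps , r)) ∷ AllPairs-map f h ps rs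

module _ {k ℓ : ℕ} {π : List ℕ} where

  complement-inBox : InBox k ℓ π → InBox k ℓ (complement ℓ π)
  complement-inBox b = record
    { length≡ = trans (length-reverse (map (ℓ ∸_) π)) (trans (length-map (ℓ ∸_) π) (length≡ b))
    ; sorted  = Linked.AllPairs⇒Linked (AllPairs-reverse
        (AllPairs-map (ℓ ∸_) (λ _ _ → ∸-monoʳ-≤ ℓ) (bounded b)
          (Linked.Linked⇒AllPairs (λ p q → ≤-trans q p) (sorted b))))
    ; bounded = All-reverse (All.map⁺ (All.map (λ {x} _ → m∸n≤m ℓ x) (bounded b)))
    }

boxcomp : {n : ℕ} {lam : Partition n} → POP lam → POP lam
boxcomp P = record
  { pattern′ = pattern′ P
  ; overlay  = λ i j p q → complement (SE (array (pattern′ P)) i j p q) (overlay P i j p q)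
  ; inBox    = λ i j p q → complement-inBox (inBox P i j p q)
  }

module _ {n : ℕ} {lam : Partition n} (F : CSF lam) where

  private
    f = entry F

  sortedRow : ℕ → List (Fin n)
  sortedRow i = Sort.sort (Fin.≤-decTotalOrder n) (map f (rowCells lam i))

  #≤ : (i j : ℕ) → ℕ
  #≤ i j = length (filter (λ a → toℕ a ≤? j) (sortedRow i))

  private
    #≤-row : ∀ i j → #≤ i j ≡ count (λ c → toℕ (f c) ≤? j) (rowCells lam i)
    #≤-row i j = trans
      (↭-length (filter-↭ (λ a → toℕ a ≤? j) (Sort.sort-↭ (Fin.≤-decTotalOrder n) _)))
      (count-map (λ a → toℕ a ≤? j) f (rowCells lam i))

    -- P is any condition forcing entries ≤ j over cells that are not
    -- above an entry ≤ j + 1.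
    SE-count : ∀ i j {P : Cell lam → Set} (P? : Decidable P) →
               (∀ x → row x ≡ i → P x → toℕ (f x) ≤ j) →
               (∀ x y → row x ≡ i → row y ≡ suc i → col y ≡ col x →
                toℕ (f y) ≤ suc j → ¬ P x) →
               count P? (rowCells lam i) + #≤ (suc i) (suc j) ≤ #≤ i j
    SE-count i j P? h d = subst₂ _≤_
      (cong (_ +_) (sym (#≤-row (suc i) (suc j)))) (sym (#≤-row i j))
      (count-tabulate P? (λ c → toℕ (f c) ≤? suc j) (λ c → toℕ (f c) ≤? j)
        (decreasing lam i) _ _
        (λ k → h _ refl)
        (λ k q → ≤-pred (<-≤-trans (strict F _ _ (col-eq k) (n<1+n i)) q))
        (λ k q → d _ _ refl refl (sym (col-eq k)) q))
      where
      col-eq : ∀ k → toℕ (inject≤ k (decreasing lam i)) ≡ toℕ k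
      col-eq k = Fin.toℕ-inject≤ k (decreasing lam i)

  rsort : GT lam
  rsort = record
    { array = λ i j _ _ → #≤ i j
    ; top   = λ i j _ _ 1+j≡n → trans
        (cong length (filter-all (λ a → toℕ a ≤? j) {sortedRow i}
          (All.tabulate λ {a} _ → ≤-pred (subst (toℕ a <_) (sym 1+j≡n) (Fin.toℕ<n a)))))
        (trans (↭-length (Sort.sort-↭ (Fin.≤-decTotalOrder n) (map f (rowCells lam i))))
          (trans (length-map f (rowCells lam i)) (length-tabulate _)))
    ; NE≥0  = λ i j _ _ → count-mono (λ a → toℕ a ≤? j) (λ a → toℕ a ≤? suc j)
        (λ _ → m≤n⇒m≤1+n) (sortedRow i)
    ; SE≥0  = λ i j _ _ → ≤-trans (m≤n+m _ _)
        (SE-count i j {λ _ → suc j ≤ 0} (λ _ → suc j ≤? 0) (λ _ _ ()) (λ _ _ _ _ _ _ ()))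
    }

  -- Maybe.All holds at nothing, which is the convention F(y) = ∞ outside the
  -- diagram.
  Between : Cell lam → Cell lam → Set
  Between c x = f x Fin.< f c × Maybe.All (λ y → f c Fin.< f y) (below x)

  between? : ∀ c x → Dec (Between c x)
  between? c x = f x Fin.<? f c ×-dec Maybe.dec (λ y → f c Fin.<? f y) (below x)

  zcountˡ zcountʳ : Cell lam → ℕ
  zcountˡ c = length (filter (λ x → col x <? col c ×-dec between? c x) (rowCells lam (row c)))
  zcountʳ c = length (filter (λ x → col c <? col x ×-dec between? c x) (rowCells lam (row c)))

  cellsWith : ℕ → ℕ → List (Cell lam)
  cellsWith i j = filter (λ c → toℕ (f c) ≟ suc j) (rowCells lam i)

  private
    Here : ℕ → ℕ → Cell lam → Set
    Here i j c = row c ≡ i × toℕ (f c) ≡ suc j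

    cellsWith-here : ∀ i j → All (Here i j) (cellsWith i j)
    cellsWith-here i j = All.zip
      ( All.filter⁺ (λ c → toℕ (f c) ≟ suc j) (All.tabulate⁺ {f = rowCell lam i} (λ _ → refl))
      , All.all-filter (λ c → toℕ (f c) ≟ suc j) (rowCells lam i))

    cellsWith-sorted : ∀ i j → AllPairs (λ c d → col c < col d) (cellsWith i j)
    cellsWith-sorted i j =
      AllPairs.filter⁺ (λ c → toℕ (f c) ≟ suc j) (AllPairs.tabulate⁺-< {f = rowCell lam i} id)

    cellsWith-length : ∀ i j → length (cellsWith i j) ≡ #≤ i (suc j) ∸ #≤ i j
    cellsWith-length i j = sym (trans
      (cong₂ _∸_ (trans (#≤-row i (suc j)) split) (#≤-row i j))
      (m+n∸m≡n (count (λ c → toℕ (f c) ≤? j) (rowCells lam i)) _))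
      where
      split = count-split (λ c → toℕ (f c) ≤? j) (λ c → toℕ (f c) ≟ suc j)
        (λ c → toℕ (f c) ≤? suc j)
        (λ _ → m≤n⇒m≤1+n) (λ _ → ≤-reflexive)
        (λ c le → case≤ (m≤n⇒m<n∨m≡n le))
        (λ _ le eq → <-irrefl refl (subst (_≤ j) eq le))
        (rowCells lam i)
        where
        case≤ : ∀ {a} → a < suc j ⊎ a ≡ suc j → a ≤ j ⊎ a ≡ suc j
        case≤ (inj₁ lt) = inj₁ (≤-pred lt)
        case≤ (inj₂ eq) = inj₂ eq

    between-below : ∀ c x y → row y ≡ suc (row x) → col y ≡ col x →
                    Between c x → f c Fin.< f y
    between-below c (cell r k p) (cell .(suc r) .k q) refl refl (_ , b)
      with k <? part lam (suc r)
    ... | yes _ with b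
    ...   | Maybe.just lt = lt
    between-below c (cell r k p) (cell .(suc r) .k q) refl refl (_ , b)
        | no ¬q = contradiction (recompute (k <? part lam (suc r)) q) ¬q

    zcount-bound : ∀ i j {P : Cell lam → Cell lam → Set} (P? : ∀ c → Decidable (P c)) c →
                   Here i j c →
                   count (λ x → P? c x ×-dec between? c x) (rowCells lam (row c))
                     ≤ #≤ i j ∸ #≤ (suc i) (suc j)
    zcount-bound i j P? c (refl , eq) = m+n≤o⇒m≤o∸n _
      (SE-count (row c) j (λ x → P? c x ×-dec between? c x)
        (λ { x _ (_ , lt , _) → ≤-pred (subst (toℕ (f x) <_) eq lt) })
        (λ { x y refl ry cy le (_ , b) →
             <⇒≱ (subst (_< toℕ (f y)) eq (between-below c x y ry cy b)) le }))

    between-cong : ∀ {i j c d} → Here i j c → Here i j d → ∀ x → Between c x → Between d x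
    between-cong {i} {j} {c} {d} (_ , p) (_ , q) x =
      subst (λ a → f x Fin.< a × Maybe.All (λ y → a Fin.< f y) (below x))
            (Fin.toℕ-injective (trans p (sym q)))

    zcountˡ-mono : ∀ {i j c d} → Here i j c → Here i j d → col c < col d → zcountˡ c ≤ zcountˡ d
    zcountˡ-mono {c = c} {d} h@(refl , _) h′@(refl , _) lt = count-mono
      (λ x → col x <? col c ×-dec between? c x) (λ x → col x <? col d ×-dec between? d x)
      (λ x (l , b) → <-trans l lt , between-cong h h′ x b) (rowCells lam (row d))

    zcountʳ-mono : ∀ {i j c d} → Here i j c → Here i j d → col c < col d → zcountʳ d ≤ zcountʳ c
    zcountʳ-mono {c = c} {d} h@(refl , _) h′@(refl , _) lt = count-mono
      (λ x → col d <? col x ×-dec between? d x) (λ x → col c <? col x ×-dec between? c x)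
      (λ x (l , b) → <-trans lt l , between-cong h′ h x b) (rowCells lam (row d))

  ψ-quinv : POP lam
  ψ-quinv = record
    { pattern′ = rsort
    ; overlay  = λ i j _ _ → map zcountˡ (reverse (cellsWith i j))
    ; inBox    = λ i j _ _ → record
      { length≡ = trans (length-map zcountˡ (reverse (cellsWith i j)))
          (trans (length-reverse (cellsWith i j)) (cellsWith-length i j))
      ; sorted  = Linked.AllPairs⇒Linked
          (AllPairs-map zcountˡ (λ h h′ → zcountˡ-mono h′ h)
            (All-reverse (cellsWith-here i j)) (AllPairs-reverse (cellsWith-sorted i j)))
      ; bounded = All.map⁺ (All.map (zcount-bound i j (λ c x → col x <? col c) _)
          (All-reverse (cellsWith-here i j)))
      }
    }

  ψ-inv : POP lam
  ψ-inv = record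
    { pattern′ = rsort
    ; overlay  = λ i j _ _ → map zcountʳ (cellsWith i j)
    ; inBox    = λ i j _ _ → record
      { length≡ = trans (length-map zcountʳ (cellsWith i j)) (cellsWith-length i j)
      ; sorted  = Linked.AllPairs⇒Linked
          (AllPairs-map zcountʳ zcountʳ-mono (cellsWith-here i j) (cellsWith-sorted i j))
      ; bounded = All.map⁺ (All.map (zcount-bound i j (λ c x → col c <? col x) _)
          (cellsWith-here i j))
      }
    }

{-# OPTIONS --safe #-}

-- Row i of a filling is recovered from row i + 1 by revealing its entries in
-- decreasing order.  Among the cells of row i not yet revealed when value a is
-- reached, those lying above an entry > a (or above nothing) number NE + SE;
-- NE of them hold a, and the remaining SE are exactly the cells counted by
-- zcount.  So the cells holding a form a lattice path in the NE × SE box whose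
-- partition is the overlay read by ψ-inv, which makes ψ-inv bijective.  The
-- two counts of a cell, to its left and to its right, add up to SE, which gives
-- ψ-quinv = boxcomp ∘ ψ-inv and the involution.  Finally, columns being
-- strict, every cell below the first row is a descent, and grouping attacking
-- pairs into triples (x, y below x, c) turns inv and quinv into the total sizes
-- of the overlays of ψ-inv and ψ-quinv.

module Submission where

open import Defs
open import Data.Bool.Base using (Bool; true; false; if_then_else_)
open import Data.Fin.Base as Fin using (Fin; toℕ; fromℕ<)
import Data.Fin.Properties as Fin
open import Data.Integer.Base as ℤ using (_⊖_)
open import Data.Integer.Properties using (⊖-≥)
open import Data.List.Base
  using (List; []; _∷_; _++_; length; map; filter; concatMap; tabulate; cartesianProduct;
         upTo; reverse)
open import Data.List.Properties
  using (map-tabulate; map-cong; map-cong-local; map-id-local; map-++; map-∘;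
         map-applyUpTo; map-upTo; reverse-map; reverse-involutive; ∷-injectiveʳ)
open import Data.List.Relation.Binary.Permutation.Propositional using (↭-sym)
open import Data.List.Relation.Binary.Permutation.Propositional.Properties
  using (↭-length; filter-↭; map⁺; ↭-reverse)
open import Data.List.Relation.Unary.All as All using (All; []; _∷_)
import Data.List.Relation.Unary.All.Properties as All
open import Data.List.Relation.Unary.Linked using (Linked; [-]; _∷_)
import Data.List.Sort as Sort
open import Data.Maybe.Base using (Maybe; just; nothing; maybe′)
import Data.Maybe.Relation.Unary.All as Maybe
import Data.Maybe.Relation.Unary.Any as MaybeAny
open import Data.Nat.Base
open import Data.Nat.ListAction using (sum)
open import Data.Nat.ListAction.Properties using (sum-++; sum-↭)
open import Data.Nat.Properties
open import Algebra.Properties.CommutativeSemigroup +-commutativeSemigroup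
  using () renaming (interchange to +-interchange)
open import Data.Product.Base using (Σ-syntax; _×_; _,_; proj₁; proj₂)
open import Data.Sum.Base using (_⊎_; inj₁; inj₂; [_,_])
open import Data.Vec.Functional using () renaming (_∷_ to _∷ᶠ_)
open import Function.Base using (_∘_)
open import Function.Bundles using (mk⇔)
open import Function.Definitions using (Inverseᵇ)
open import Level using (0ℓ)
open import Relation.Binary.Bundles using (Setoid)
open import Relation.Binary.Definitions using () renaming (Decidable to Decidable₂)
open import Relation.Binary.PropositionalEquality hiding ([_])
open import Relation.Nullary.Decidable
  using (Dec; yes; no; does; dec-true; dec-false; does-⇔; recompute; _×-dec_; _⊎-dec_)
open import Relation.Nullary.Negation using (¬_; contradiction)
open import Relation.Unary using (Decidable)

-- Each reveal is forced cell by cell, and one observation gives both existence and uniqueness. Scan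
-- a row from the left, and let `ℓ` count the cells, from the current one on, that lie over an entry
-- above `a` and end up below `a`. If the current cell holds `a`, its part is all of `ℓ`; if it is a
-- free cell left below `a`, it uses up one unit and every later part is at most `ℓ - 1`. So a free
-- cell takes `a` exactly when the next part equals `ℓ`. A half-revealed row is represented by
-- `x ⊔ b`, in which all entries up to `b` look like `b`: it is again an ordinary row, and
-- everything about values above `b` is already final. The values descend from `n - 1` to `i`, the
-- least entry possible in row `i`, so the last placeholder is itself the right entry. Rows are
-- treated upwards from the empty row `n`, because a zcount compares a row only with the one beneath
-- it.

𝟙 : {P : Set} → Dec P → ℕ
𝟙 p? = if does p? then 1 else 0

𝟙-yes : {P : Set} (p? : Dec P) → P → 𝟙 p? ≡ 1
𝟙-yes p? p rewrite dec-true p? p = refl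

𝟙-no : {P : Set} (p? : Dec P) → ¬ P → 𝟙 p? ≡ 0
𝟙-no p? ¬p rewrite dec-false p? ¬p = refl

𝟙-cong : {P Q : Set} (p? : Dec P) (q? : Dec Q) → (P → Q) → (Q → P) → 𝟙 p? ≡ 𝟙 q?
𝟙-cong p? q? f g rewrite does-⇔ (mk⇔ f g) p? q? = refl

𝟙-⊎ : {P Q R : Set} (p? : Dec P) (q? : Dec Q) (r? : Dec R) →
      (P → R) → (Q → R) → (R → P ⊎ Q) → (P → ¬ Q) → 𝟙 p? + 𝟙 q? ≡ 𝟙 r?
𝟙-⊎ (yes p) (yes q) r? f g h d = contradiction q (d p)
𝟙-⊎ (yes p) (no _)  r? f g h d = sym (𝟙-yes r? (f p))
𝟙-⊎ (no _)  (yes q) r? f g h d = sym (𝟙-yes r? (g q))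
𝟙-⊎ (no ¬p) (no ¬q) r? f g h d = sym (𝟙-no r? λ r → [ ¬p , ¬q ] (h r))

-- Finite sums over lists and over `Fin m`.

module _ {A : Set} where

  ∑ : List A → (A → ℕ) → ℕ
  ∑ xs g = sum (map g xs)

  ∑-cong : ∀ xs {g h : A → ℕ} → (∀ x → g x ≡ h x) → ∑ xs g ≡ ∑ xs h
  ∑-cong xs e = cong sum (map-cong e xs)

  ∑-0 : ∀ xs {g : A → ℕ} → (∀ x → g x ≡ 0) → ∑ xs g ≡ 0
  ∑-0 [] e = refl
  ∑-0 (x ∷ xs) e = cong₂ _+_ (e x) (∑-0 xs e)

  ∑-+ : ∀ xs (g h : A → ℕ) → ∑ xs (λ x → g x + h x) ≡ ∑ xs g + ∑ xs h
  ∑-+ [] g h = refl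
  ∑-+ (x ∷ xs) g h =
    trans (cong (g x + h x +_) (∑-+ xs g h)) (+-interchange (g x) (h x) _ _)

  ∑-++ : ∀ xs ys (g : A → ℕ) → ∑ (xs ++ ys) g ≡ ∑ xs g + ∑ ys g
  ∑-++ xs ys g = trans (cong sum (map-++ g xs ys)) (sum-++ (map g xs) (map g ys))

  length-filter-∑ : ∀ {P : A → Set} (P? : Decidable P) xs → length (filter P? xs) ≡ ∑ xs (𝟙 ∘ P?)
  length-filter-∑ P? [] = refl
  length-filter-∑ P? (x ∷ xs) with P? x
  ... | yes _ = cong suc (length-filter-∑ P? xs)
  ... | no  _ = length-filter-∑ P? xs

  ∑-filter : ∀ {P : A → Set} (P? : Decidable P) xs (g : A → ℕ) →
             ∑ (filter P? xs) g ≡ ∑ xs (λ x → 𝟙 (P? x) * g x)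
  ∑-filter P? [] g = refl
  ∑-filter P? (x ∷ xs) g with P? x
  ... | yes _ = cong₂ _+_ (sym (+-identityʳ (g x))) (∑-filter P? xs g)
  ... | no  _ = ∑-filter P? xs g

module _ {A B : Set} where

  ∑-swap : ∀ (xs : List A) (ys : List B) (g : A → B → ℕ) →
           ∑ xs (λ x → ∑ ys (g x)) ≡ ∑ ys (λ y → ∑ xs (λ x → g x y))
  ∑-swap [] ys g = sym (∑-0 ys λ _ → refl)
  ∑-swap (x ∷ xs) ys g =
    trans (cong (∑ ys (g x) +_) (∑-swap xs ys g)) (sym (∑-+ ys (g x) _))

  ∑-concatMap : ∀ (k : A → List B) xs (g : B → ℕ) → ∑ (concatMap k xs) g ≡ ∑ xs (λ x → ∑ (k x) g)
  ∑-concatMap k [] g = refl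
  ∑-concatMap k (x ∷ xs) g =
    trans (∑-++ (k x) (concatMap k xs) g) (cong (∑ (k x) g +_) (∑-concatMap k xs g))

  ∑-cartesianProduct : ∀ (xs : List A) (ys : List B) (g : A × B → ℕ) →
                       ∑ (cartesianProduct xs ys) g ≡ ∑ xs (λ x → ∑ ys (λ y → g (x , y)))
  ∑-cartesianProduct [] ys g = refl
  ∑-cartesianProduct (x ∷ xs) ys g =
    trans (∑-++ (map (x ,_) ys) (cartesianProduct xs ys) g)
      (cong₂ _+_ (cong sum (sym (map-∘ ys))) (∑-cartesianProduct xs ys g))

∑-upTo-suc : ∀ n (g : ℕ → ℕ) → ∑ (upTo (suc n)) g ≡ g 0 + ∑ (upTo n) (g ∘ suc)
∑-upTo-suc n g = cong (g 0 +_)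
  (cong sum (trans (map-applyUpTo suc g n) (sym (map-upTo (g ∘ suc) n))))

-- Both sides run over 0, ..., n. Used to trade the first row for the empty row `n` when descents
-- are summed.
∑-upTo-shift : ∀ n (g : ℕ → ℕ) → g 0 + ∑ (upTo n) (g ∘ suc) ≡ ∑ (upTo n) g + g n
∑-upTo-shift zero g = +-identityʳ (g 0)
∑-upTo-shift (suc n) g = begin
  g 0 + ∑ (upTo (suc n)) (g ∘ suc)                  ≡⟨ cong (g 0 +_) (∑-upTo-suc n (g ∘ suc)) ⟩
  g 0 + (g 1 + ∑ (upTo n) (g ∘ suc ∘ suc))          ≡⟨ cong (g 0 +_) (∑-upTo-shift n (g ∘ suc)) ⟩
  g 0 + (∑ (upTo n) (g ∘ suc) + g (suc n))          ≡⟨ +-assoc (g 0) _ _ ⟨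
  (g 0 + ∑ (upTo n) (g ∘ suc)) + g (suc n)          ≡⟨ cong (_+ g (suc n)) (∑-upTo-suc n g) ⟨
  ∑ (upTo (suc n)) g + g (suc n)                    ∎
  where open ≡-Reasoning

-- The index `r` may fall outside the range, since the row beneath the last one is also asked about;
-- the last hypothesis covers that case.
∑-upTo-select : ∀ n r (g : ℕ → ℕ) → (∀ i → i ≢ r → g i ≡ 0) → (n ≤ r → g r ≡ 0) →
                ∑ (upTo n) g ≡ g r
∑-upTo-select zero r g e z = sym (z z≤n)
∑-upTo-select (suc n) zero g e z = begin
  ∑ (upTo (suc n)) g          ≡⟨ ∑-upTo-suc n g ⟩
  g 0 + ∑ (upTo n) (g ∘ suc)  ≡⟨ cong (g 0 +_) (∑-0 (upTo n) λ i → e (suc i) λ ()) ⟩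
  g 0 + 0                     ≡⟨ +-identityʳ (g 0) ⟩
  g 0                         ∎
  where open ≡-Reasoning
∑-upTo-select (suc n) (suc r) g e z = begin
  ∑ (upTo (suc n)) g          ≡⟨ ∑-upTo-suc n g ⟩
  g 0 + ∑ (upTo n) (g ∘ suc)  ≡⟨ cong (_+ ∑ (upTo n) (g ∘ suc)) (e 0 λ ()) ⟩
  ∑ (upTo n) (g ∘ suc)        ≡⟨ ∑-upTo-select n r (g ∘ suc)
                                   (λ i i≢r → e (suc i) (i≢r ∘ suc-injective)) (z ∘ s≤s) ⟩
  g (suc r)                   ∎
  where open ≡-Reasoning

∑ᶠ : ∀ {m} → (Fin m → ℕ) → ℕ
∑ᶠ g = sum (tabulate g)

∑-tabulate : ∀ {A : Set} {m} (f : Fin m → A) (g : A → ℕ) → ∑ (tabulate f) g ≡ ∑ᶠ (g ∘ f)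
∑-tabulate f g = cong sum (map-tabulate f g)

∑ᶠ-cong : ∀ {m} {g h : Fin m → ℕ} → (∀ k → g k ≡ h k) → ∑ᶠ g ≡ ∑ᶠ h
∑ᶠ-cong {zero} e = refl
∑ᶠ-cong {suc m} e = cong₂ _+_ (e Fin.zero) (∑ᶠ-cong (e ∘ Fin.suc))

∑ᶠ-+ : ∀ {m} (g h : Fin m → ℕ) → ∑ᶠ (λ k → g k + h k) ≡ ∑ᶠ g + ∑ᶠ h
∑ᶠ-+ {zero} g h = refl
∑ᶠ-+ {suc m} g h =
  trans (cong (g Fin.zero + h Fin.zero +_) (∑ᶠ-+ (g ∘ Fin.suc) (h ∘ Fin.suc)))
    (+-interchange (g Fin.zero) (h Fin.zero) _ _)

∑ᶠ-0 : ∀ {m} {g : Fin m → ℕ} → (∀ k → g k ≡ 0) → ∑ᶠ g ≡ 0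
∑ᶠ-0 {zero} e = refl
∑ᶠ-0 {suc m} e = cong₂ _+_ (e Fin.zero) (∑ᶠ-0 (e ∘ Fin.suc))

∑ᶠ-1 : ∀ {m} {g : Fin m → ℕ} → (∀ k → g k ≡ 1) → ∑ᶠ g ≡ m
∑ᶠ-1 {zero} e = refl
∑ᶠ-1 {suc m} e = cong₂ _+_ (e Fin.zero) (∑ᶠ-1 (e ∘ Fin.suc))

-- Padding a row to the length of the row above it.

module _ {A : Set} where

  -- Aligns a row with the longer one above, `d` filling the columns with nothing beneath. Recursion
  -- on `l` makes it total without a proof of `l ≤ m`.
  extend : ∀ {l m} → A → (Fin l → A) → Fin m → A
  extend {zero} d x k = d
  extend {suc l} d x Fin.zero = x Fin.zero
  extend {suc l} d x (Fin.suc k) = extend d (x ∘ Fin.suc) k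

  extend-< : ∀ {l m} d (x : Fin l → A) (k : Fin m) (k<l : toℕ k < l) →
             extend d x k ≡ x (fromℕ< k<l)
  extend-< {suc l} d x Fin.zero k<l = refl
  extend-< {suc l} d x (Fin.suc k) k<l = extend-< d (x ∘ Fin.suc) k (s<s⁻¹ k<l)

  extend-≥ : ∀ {l m} d (x : Fin l → A) (k : Fin m) → l ≤ toℕ k → extend d x k ≡ d
  extend-≥ {zero} d x k l≤k = refl
  extend-≥ {suc l} d x (Fin.suc k) l≤k = extend-≥ d (x ∘ Fin.suc) k (s≤s⁻¹ l≤k)

  extend-cong : ∀ {l m} d {x y : Fin l → A} → (∀ k → x k ≡ y k) → (k : Fin m) →
                extend d x k ≡ extend d y k
  extend-cong {zero} d e k = refl
  extend-cong {suc l} d e Fin.zero = e Fin.zero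
  extend-cong {suc l} d e (Fin.suc k) = extend-cong d (e ∘ Fin.suc) k

  extend-elim : ∀ {l m} (P : A → Set) {d} {x : Fin l → A} → P d → (∀ k → P (x k)) →
                (k : Fin m) → P (extend d x k)
  extend-elim {zero} P pd px k = pd
  extend-elim {suc l} P pd px Fin.zero = px Fin.zero
  extend-elim {suc l} P pd px (Fin.suc k) = extend-elim P pd (px ∘ Fin.suc) k

extend-map : ∀ {A B : Set} {l m} (h : A → B) d (x : Fin l → A) (k : Fin m) →
             h (extend d x k) ≡ extend (h d) (h ∘ x) k
extend-map {l = zero} h d x k = refl
extend-map {l = suc l} h d x Fin.zero = refl
extend-map {l = suc l} h d x (Fin.suc k) = extend-map h d (x ∘ Fin.suc) k

∑ᶠ-extend : ∀ {l m} → l ≤ m → (q : Fin l → ℕ) → ∑ᶠ {m} (extend 0 q) ≡ ∑ᶠ q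
∑ᶠ-extend {m = m} z≤n q = ∑ᶠ-0 {m} λ _ → refl
∑ᶠ-extend (s≤s l≤m) q = cong (q Fin.zero +_) (∑ᶠ-extend l≤m (q ∘ Fin.suc))

-- Counts on either side of a position, and codes of lattice paths.

before after : ∀ {m} → (Fin m → ℕ) → Fin m → ℕ
before g Fin.zero    = 0
before g (Fin.suc k) = g Fin.zero + before (g ∘ Fin.suc) k
after g Fin.zero     = ∑ᶠ (g ∘ Fin.suc)
after g (Fin.suc k)  = after (g ∘ Fin.suc) k

before+after : ∀ {m} (g : Fin m → ℕ) k → g k ≡ 0 → before g k + after g k ≡ ∑ᶠ g
before+after g Fin.zero    e = cong (_+ ∑ᶠ (g ∘ Fin.suc)) (sym e)
before+after g (Fin.suc k) e =
  trans (+-assoc (g Fin.zero) _ _) (cong (g Fin.zero +_) (before+after (g ∘ Fin.suc) k e))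

∑ᶠ-before : ∀ {m} {P : Fin m → Set} (P? : Decidable P) k →
            ∑ᶠ (λ l → 𝟙 (toℕ l <? toℕ k ×-dec P? l)) ≡ before (𝟙 ∘ P?) k
∑ᶠ-before P? Fin.zero    = ∑ᶠ-0 λ l → 𝟙-no (toℕ l <? 0 ×-dec P? l) λ ()
∑ᶠ-before P? (Fin.suc k) = cong₂ _+_
  (𝟙-cong (0 <? suc (toℕ k) ×-dec P? Fin.zero) (P? Fin.zero) proj₂ (z<s ,_))
  (trans
    (∑ᶠ-cong λ l → 𝟙-cong (suc (toℕ l) <? suc (toℕ k) ×-dec P? (Fin.suc l))
                          (toℕ l <? toℕ k ×-dec P? (Fin.suc l))
                          (λ (lt , p) → s<s⁻¹ lt , p) (λ (lt , p) → s<s lt , p))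
    (∑ᶠ-before (P? ∘ Fin.suc) k))

∑ᶠ-after : ∀ {m} {P : Fin m → Set} (P? : Decidable P) k →
           ∑ᶠ (λ l → 𝟙 (toℕ k <? toℕ l ×-dec P? l)) ≡ after (𝟙 ∘ P?) k
∑ᶠ-after P? Fin.zero    = cong₂ _+_
  (𝟙-no (0 <? 0 ×-dec P? Fin.zero) λ ())
  (∑ᶠ-cong λ l → 𝟙-cong (0 <? suc (toℕ l) ×-dec P? (Fin.suc l)) (P? (Fin.suc l)) proj₂ (z<s ,_))
∑ᶠ-after P? (Fin.suc k) = cong₂ _+_
  (𝟙-no (suc (toℕ k) <? 0 ×-dec P? Fin.zero) λ ())
  (trans
    (∑ᶠ-cong λ l → 𝟙-cong (suc (toℕ k) <? suc (toℕ l) ×-dec P? (Fin.suc l))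
                          (toℕ k <? toℕ l ×-dec P? (Fin.suc l))
                          (λ (lt , p) → s<s⁻¹ lt , p) (λ (lt , p) → s<s lt , p))
    (∑ᶠ-after (P? ∘ Fin.suc) k))

-- Read as a lattice path, e marking one kind of step and g the other, this is
-- the list of parts of the partition cut out by the path.
code : ∀ {m} → (Fin m → Bool) → (Fin m → ℕ) → List ℕ
code {zero}  e g = []
code {suc m} e g with e Fin.zero
... | true  = ∑ᶠ (g ∘ Fin.suc) ∷ code (e ∘ Fin.suc) (g ∘ Fin.suc)
... | false = code (e ∘ Fin.suc) (g ∘ Fin.suc)

code-true : ∀ {m} (e : Fin (suc m) → Bool) g → e Fin.zero ≡ true →
            code e g ≡ ∑ᶠ (g ∘ Fin.suc) ∷ code (e ∘ Fin.suc) (g ∘ Fin.suc)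
code-true e g eq rewrite eq = refl

code-false : ∀ {m} (e : Fin (suc m) → Bool) g → e Fin.zero ≡ false →
             code e g ≡ code (e ∘ Fin.suc) (g ∘ Fin.suc)
code-false e g eq rewrite eq = refl

code-cong : ∀ {m} {e e′ : Fin m → Bool} {g g′ : Fin m → ℕ} →
            (∀ k → e k ≡ e′ k) → (∀ k → g k ≡ g′ k) → code e g ≡ code e′ g′
code-cong {zero} p q = refl
code-cong {suc m} {e} {e′} p q with e Fin.zero | e′ Fin.zero | p Fin.zero
... | true  | .true  | refl = cong₂ _∷_ (∑ᶠ-cong (q ∘ Fin.suc)) (code-cong (p ∘ Fin.suc) (q ∘ Fin.suc))
... | false | .false | refl = code-cong (p ∘ Fin.suc) (q ∘ Fin.suc)

-- Each part is the sum of `g` over a final segment.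
code-≤ : ∀ {m} (e : Fin m → Bool) g → All (_≤ ∑ᶠ g) (code e g)
code-≤ {zero} e g = []
code-≤ {suc m} e g with e Fin.zero | code-≤ (e ∘ Fin.suc) (g ∘ Fin.suc)
... | true  | ps = m≤n+m _ (g Fin.zero) ∷ All.map (λ p → m≤n⇒m≤o+n (g Fin.zero) p) ps
... | false | ps = All.map (λ p → m≤n⇒m≤o+n (g Fin.zero) p) ps

-- By definition `after` at a successor is `after` on the tail, so the hypothesis restricts to the
-- tail and the filter follows the recursion of `code`.
map-filter-tabulate : ∀ {A : Set} {P : A → Set} (P? : Decidable P) (Z : A → ℕ) {m} (f : Fin m → A)
                      (g : Fin m → ℕ) → (∀ k → P (f k) → Z (f k) ≡ after g k) →
                      map Z (filter P? (tabulate f)) ≡ code (does ∘ P? ∘ f) g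
map-filter-tabulate P? Z {zero} f g h = refl
map-filter-tabulate P? Z {suc m} f g h
  with P? (f Fin.zero) | h Fin.zero | map-filter-tabulate P? Z (f ∘ Fin.suc) (g ∘ Fin.suc) (h ∘ Fin.suc)
... | yes p | e | ih = cong₂ _∷_ (e p) ih
... | no _  | _ | ih = ih

-- Codes and counts of a row `x` over a row `y`.

module _ {m : ℕ} (a : ℕ) (x y : Fin m → ℕ) where

  between : Fin m → ℕ
  between k = 𝟙 (x k <? a ×-dec a <? y k)

  #between : ℕ
  #between = ∑ᶠ between

  rowCode : List ℕ
  rowCode = code (λ k → does (x k ≟ a)) between

module _ {m : ℕ} (a : ℕ) (x y : Fin (suc m) → ℕ) where

  rowCode-≡ : x Fin.zero ≡ a → rowCode a x y
              ≡ #between a (x ∘ Fin.suc) (y ∘ Fin.suc) ∷ rowCode a (x ∘ Fin.suc) (y ∘ Fin.suc)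
  rowCode-≡ e = code-true (λ k → does (x k ≟ a)) (between a x y) (dec-true (x Fin.zero ≟ a) e)

  rowCode-≢ : x Fin.zero ≢ a → rowCode a x y ≡ rowCode a (x ∘ Fin.suc) (y ∘ Fin.suc)
  rowCode-≢ ne = code-false (λ k → does (x k ≟ a)) (between a x y) (dec-false (x Fin.zero ≟ a) ne)

#≤ᶠ : ∀ {m} → (Fin m → ℕ) → ℕ → ℕ
#≤ᶠ x j = ∑ᶠ λ k → 𝟙 (x k ≤? j)

#≤ᶠ-cong : ∀ {m} {x x′ : Fin m → ℕ} j → (∀ k → x k ≡ x′ k) → #≤ᶠ x j ≡ #≤ᶠ x′ j
#≤ᶠ-cong j e = ∑ᶠ-cong λ k → cong (λ v → 𝟙 (v ≤? j)) (e k)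

rowCode-cong : ∀ {m} a {x x′ y y′ : Fin m → ℕ} → (∀ k → x k ≡ x′ k) → (∀ k → y k ≡ y′ k) →
               rowCode a x y ≡ rowCode a x′ y′
rowCode-cong a p q = code-cong (λ k → cong (λ v → does (v ≟ a)) (p k))
  (λ k → cong₂ (λ v w → 𝟙 (v <? a ×-dec a <? w)) (p k) (q k))

#between-cong : ∀ {m} a {x x′ y y′ : Fin m → ℕ} → (∀ k → x k ≡ x′ k) → (∀ k → y k ≡ y′ k) →
                #between a x y ≡ #between a x′ y′
#between-cong a p q = ∑ᶠ-cong λ k → cong₂ (λ v w → 𝟙 (v <? a ×-dec a <? w)) (p k) (q k)

-- Cells with `x ≤ b` are sorted by whether `y` exceeds `a`; the hypothesis says that `y ≤ a`
-- already forces `x ≤ b`. With `x < suc b` the summand is literally `between` when `a` is `suc b`,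
-- and `free` when `b` is `a`.
∑ᶠ-split : ∀ {m} b a (x y : Fin m → ℕ) → (∀ k → y k ≤ a → x k ≤ b) →
           ∑ᶠ (λ k → 𝟙 (x k <? suc b ×-dec a <? y k)) + #≤ᶠ y a ≡ #≤ᶠ x b
∑ᶠ-split b a x y h = trans
  (sym (∑ᶠ-+ (λ k → 𝟙 (x k <? suc b ×-dec a <? y k)) (λ k → 𝟙 (y k ≤? a))))
  (∑ᶠ-cong λ k → 𝟙-⊎ (x k <? suc b ×-dec a <? y k) (y k ≤? a) (x k ≤? b)
    (λ (x<1+b , _) → s≤s⁻¹ x<1+b) (h k) (λ x≤b → split x≤b (≤-<-connex (y k) a))
    (λ (_ , a<y) y≤a → <⇒≱ a<y y≤a))
  where
  split : ∀ {v w} → v ≤ b → w ≤ a ⊎ a < w → (v < suc b × a < w) ⊎ w ≤ a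
  split x≤b (inj₁ y≤a) = inj₂ y≤a
  split x≤b (inj₂ a<y) = inj₁ (s≤s x≤b , a<y)

#≤ᶠ-extend : ∀ {l m} → l ≤ m → ∀ {d} (x : Fin l → ℕ) j → j < d → #≤ᶠ {m} (extend d x) j ≡ #≤ᶠ x j
#≤ᶠ-extend {m = m} l≤m {d} x j j<d = trans
  (∑ᶠ-cong λ (k : Fin m) → trans (extend-map (λ v → 𝟙 (v ≤? j)) d x k)
    (cong (λ v → extend v (λ l → 𝟙 (x l ≤? j)) k) (𝟙-no (d ≤? j) (<⇒≱ j<d))))
  (∑ᶠ-extend l≤m (λ l → 𝟙 (x l ≤? j)))

module _ {a c : ℕ} (a<c : a < c) where

  ⊔-≡⁻ : ∀ v → v ⊔ a ≡ c → v ≡ c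
  ⊔-≡⁻ v eq with ⊔-sel v a
  ... | inj₁ e = trans (sym e) eq
  ... | inj₂ e = contradiction (trans (sym e) eq) (<⇒≢ a<c)

  -- The code for `c` sees an entry only through its comparison with `c`, which raising to `a < c`
  -- does not change. Hence codes of larger values survive later reveals.
  rowCode-⊔ : ∀ {m} (x y : Fin m → ℕ) → rowCode c (λ k → x k ⊔ a) y ≡ rowCode c x y
  rowCode-⊔ x y = code-cong
    (λ k → does-⇔ (mk⇔ (⊔-≡⁻ (x k)) (λ e → trans (cong (_⊔ a) e) (m≥n⇒m⊔n≡m (<⇒≤ a<c))))
                  (x k ⊔ a ≟ c) (x k ≟ c))
    (λ k → 𝟙-cong (x k ⊔ a <? c ×-dec c <? y k) (x k <? c ×-dec c <? y k)
      (λ (lt , r) → ≤-<-trans (m≤m⊔n (x k) a) lt , r) (λ (lt , r) → ⊔-lub lt a<c , r))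

#≤ᶠ-⊔ : ∀ {m} {a j} → a ≤ j → (x : Fin m → ℕ) → #≤ᶠ (λ k → x k ⊔ a) j ≡ #≤ᶠ x j
#≤ᶠ-⊔ {a = a} {j} a≤j x = ∑ᶠ-cong λ k → 𝟙-cong (x k ⊔ a ≤? j) (x k ≤? j)
  (≤-trans (m≤m⊔n (x k) a)) (λ le → ⊔-lub le a≤j)

-- One reveal step: existence.

-- The entries of a row are revealed in decreasing order: x ⊔ a shows those
-- above a, and passing from a = b + 1 to b splits the remaining cells with
-- a < y, of which exactly those holding a contribute a part to the code.
record Refinement {m} (b : ℕ) (x y : Fin m → ℕ) (π : List ℕ) (ℓ : ℕ) : Set where
  field
    revealed : Fin m → ℕ
    b≤       : ∀ k → b ≤ revealed k
    refines  : ∀ k → revealed k ⊔ suc b ≡ x k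
    fits     : ∀ k → b < revealed k → revealed k < y k
    code≡    : rowCode (suc b) revealed y ≡ π
    between≡ : #between (suc b) revealed y ≡ ℓ

module _ {m b : ℕ} {x y : Fin (suc m) → ℕ} {π : List ℕ} {ℓ : ℕ}
         (R : Refinement b (x ∘ Fin.suc) (y ∘ Fin.suc) π ℓ) where

  open Refinement

  -- All `ℓ` counted cells lie to the right of the new head, so its part is `ℓ`; holding `a`, the
  -- head is not counted itself.
  place : x Fin.zero ≡ suc b → suc b < y Fin.zero → Refinement b x y (ℓ ∷ π) ℓ
  place eq a<y = record
    { revealed = x′
    ; b≤       = λ { Fin.zero → n≤1+n b ; (Fin.suc k) → b≤ R k }
    ; refines  = λ { Fin.zero → trans (⊔-idem (suc b)) (sym eq) ; (Fin.suc k) → refines R k }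
    ; fits     = λ { Fin.zero _ → a<y ; (Fin.suc k) → fits R k }
    ; code≡    = trans
        (rowCode-≡ (suc b) x′ y refl)
        (cong₂ _∷_ (between≡ R) (code≡ R))
    ; between≡ = trans
        (cong (_+ #between (suc b) (revealed R) (y ∘ Fin.suc))
          (𝟙-no (suc b <? suc b ×-dec suc b <? y Fin.zero) (λ (lt , _) → <-irrefl refl lt)))
        (between≡ R)
    }
    where x′ = suc b ∷ᶠ revealed R

  -- Serves three cases: an entry above `a` that is already known, a cell blocked by `y ≤ a`, and a
  -- free cell left below `a`. Only the last one increases the count.
  skip : ∀ v → v ≢ suc b → b ≤ v → v ⊔ suc b ≡ x Fin.zero → (b < v → v < y Fin.zero) →
         ∀ {ℓ′} → 𝟙 (v <? suc b ×-dec suc b <? y Fin.zero) + ℓ ≡ ℓ′ → Refinement b x y π ℓ′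
  skip v v≢a b≤v eq v<y eqℓ = record
    { revealed = x′
    ; b≤       = λ { Fin.zero → b≤v ; (Fin.suc k) → b≤ R k }
    ; refines  = λ { Fin.zero → eq ; (Fin.suc k) → refines R k }
    ; fits     = λ { Fin.zero → v<y ; (Fin.suc k) → fits R k }
    ; code≡    = trans
        (rowCode-≢ (suc b) x′ y v≢a)
        (code≡ R)
    ; between≡ = trans (cong (𝟙 (v <? suc b ×-dec suc b <? y Fin.zero) +_) (between≡ R)) eqℓ
    }
    where x′ = v ∷ᶠ revealed R

-- The candidates for the value `a`: in a row capped at `a`, the condition `x k < suc a` singles out
-- the placeholder.
free : ∀ {m} → ℕ → (x y : Fin m → ℕ) → Fin m → ℕ
free a x y k = 𝟙 (x k <? suc a ×-dec a <? y k)

-- `Linked _≥_ (ℓ ∷ π)` says at once that `π` decreases and that its parts are at most `ℓ`. The size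
-- equation reserves one free cell for each part and one for each of the `ℓ` cells to be left below
-- `suc b`. Both conditions pass to the tail, whichever choice is made at the head.
refine : ∀ {m} b (x y : Fin m → ℕ) π ℓ →
         (∀ k → suc b ≤ x k) → (∀ k → suc b < x k → x k < y k) →
         Linked _≥_ (ℓ ∷ π) → length π + ℓ ≡ ∑ᶠ (free (suc b) x y) → Refinement b x y π ℓ
refine {zero} b x y [] zero a≤x x<y [-] eq = record
  { revealed = λ () ; b≤ = λ () ; refines = λ () ; fits = λ () ; code≡ = refl ; between≡ = refl }
refine {suc m} b x y π ℓ a≤x x<y sorted eq = go (x Fin.zero <? suc a) (a <? y Fin.zero)
  where
  a : ℕ
  a = suc b
  x₊ y₊ : Fin m → ℕ
  x₊ = x ∘ Fin.suc
  y₊ = y ∘ Fin.suc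

  rest : ∀ π ℓ → Linked _≥_ (ℓ ∷ π) → length π + ℓ ≡ ∑ᶠ (free a x₊ y₊) → Refinement b x₊ y₊ π ℓ
  rest π ℓ = refine b x₊ y₊ π ℓ (a≤x ∘ Fin.suc) (x<y ∘ Fin.suc)

  size : ∀ {v} → free a x y Fin.zero ≡ v → length π + ℓ ≡ v + ∑ᶠ (free a x₊ y₊)
  size e = trans eq (cong (_+ ∑ᶠ (free a x₊ y₊)) e)

  head? : Dec (x Fin.zero < suc a × a < y Fin.zero)
  head? = x Fin.zero <? suc a ×-dec a <? y Fin.zero

  lower : x Fin.zero < suc a → b ⊔ a ≡ x Fin.zero
  lower x≤a = trans (m≤n⇒m⊔n≡n (n≤1+n b)) (≤-antisym (a≤x Fin.zero) (s≤s⁻¹ x≤a))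

  skip-b : ∀ {π ℓ ℓ′} → x Fin.zero < suc a → Refinement b x₊ y₊ π ℓ →
           𝟙 (b <? a ×-dec a <? y Fin.zero) + ℓ ≡ ℓ′ → Refinement b x y π ℓ′
  skip-b x≤a R = skip R b (<⇒≢ ≤-refl) ≤-refl (lower x≤a) (λ b<b → contradiction b<b (<-irrefl refl))

  choose : x Fin.zero < suc a → a < y Fin.zero → ∀ π ℓ → Linked _≥_ (ℓ ∷ π) →
           length π + ℓ ≡ suc (∑ᶠ (free a x₊ y₊)) → Refinement b x y π ℓ
  -- No part is left, so the free head stays below `a`; the size equation makes the count positive.
  choose x≤a a<y [] (suc ℓ) [-] eq = skip-b x≤a (rest [] ℓ [-] (suc-injective eq))
    (cong (_+ ℓ) (𝟙-yes (b <? a ×-dec a <? y Fin.zero) (≤-refl , a<y)))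
  choose x≤a a<y (p ∷ π) ℓ (ℓ≥p ∷ ps) eq with m≤n⇒m<n∨m≡n ℓ≥p
  -- The next part counts every cell still to be left below `a`, so the head is not one of them.
  ... | inj₂ refl =
    place (rest π ℓ ps (suc-injective eq)) (≤-antisym (s≤s⁻¹ x≤a) (a≤x Fin.zero)) a<y
  -- Holding `a` here would produce a first part larger than `p`, so the head stays below.
  choose x≤a a<y (p ∷ π) (suc ℓ) (ℓ≥p ∷ ps) eq | inj₁ p<ℓ = skip-b x≤a
    (rest (p ∷ π) ℓ (s≤s⁻¹ p<ℓ ∷ ps) (trans (sym (+-suc (length π) ℓ)) (suc-injective eq)))
    (cong (_+ ℓ) (𝟙-yes (b <? a ×-dec a <? y Fin.zero) (≤-refl , a<y)))

  go : Dec (x Fin.zero < suc a) → Dec (a < y Fin.zero) → Refinement b x y π ℓ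
  go (no x≰a) _ = skip (rest π ℓ sorted (size (𝟙-no head? (x≰a ∘ proj₁))))
    (x Fin.zero) (<⇒≢ a<x ∘ sym) (≤-trans (n≤1+n b) (a≤x Fin.zero)) (m≥n⇒m⊔n≡m (a≤x Fin.zero))
    (λ _ → x<y Fin.zero a<x)
    (cong (_+ ℓ) (𝟙-no (x Fin.zero <? a ×-dec a <? y Fin.zero) (λ (lt , _) → <-asym a<x lt)))
    where a<x = ≮⇒≥ x≰a
  go (yes x≤a) (no a≮y) = skip-b x≤a (rest π ℓ sorted (size (𝟙-no head? (a≮y ∘ proj₂))))
    (cong (_+ ℓ) (𝟙-no (b <? a ×-dec a <? y Fin.zero) (a≮y ∘ proj₂)))
  go (yes x≤a) (yes a<y) = choose x≤a a<y π ℓ sorted (size (𝟙-yes head? (x≤a , a<y)))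

-- One reveal step: uniqueness.

≡⊎≤ : ∀ a v w → v ⊔ a ≡ w ⊔ a → v ≡ w ⊎ (v ≤ a × w ≤ a)
≡⊎≤ a v w eq with ≤-total v a | ≤-total w a
... | inj₁ v≤a | inj₁ w≤a = inj₂ (v≤a , w≤a)
... | inj₁ v≤a | inj₂ a≤w = inj₂ (v≤a ,
  subst (_≤ a) (m≥n⇒m⊔n≡m a≤w) (≤-reflexive (trans (sym eq) (m≤n⇒m⊔n≡n v≤a))))
... | inj₂ a≤v | inj₁ w≤a = inj₂ (
  subst (_≤ a) (m≥n⇒m⊔n≡m a≤v) (≤-reflexive (trans eq (m≤n⇒m⊔n≡n w≤a))) , w≤a)
... | inj₂ a≤v | inj₂ a≤w = inj₁ (trans (sym (m≥n⇒m⊔n≡m a≤v)) (trans eq (m≥n⇒m⊔n≡m a≤w)))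

module _ {m : ℕ} (b : ℕ) where

  private
    a = suc b

  between-same : ∀ (x x′ y : Fin (suc m) → ℕ) → between a x y Fin.zero ≡ between a x′ y Fin.zero →
    #between a x y ≡ #between a x′ y →
    #between a (x ∘ Fin.suc) (y ∘ Fin.suc) ≡ #between a (x′ ∘ Fin.suc) (y ∘ Fin.suc)
  between-same x x′ y e eq = +-cancelˡ-≡ (between a x y Fin.zero) _ _
    (trans eq (cong (_+ #between a (x′ ∘ Fin.suc) (y ∘ Fin.suc)) (sym e)))

  -- The first part of the left code is the total count ℓ, which exceeds every
  -- part of the right code, because its first cell is counted in ℓ.
  clash : ∀ (x x′ y : Fin (suc m) → ℕ) → x Fin.zero ≡ a → x′ Fin.zero < a → a < y Fin.zero →
          rowCode a x y ≡ rowCode a x′ y → ¬ (#between a x y ≡ #between a x′ y)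
  clash x x′ y x≡a x′<a a<y eqc eqz = <-irrefl refl (begin-strict
    ℓ           ≤⟨ All.head (subst (All (_≤ ℓ′)) (sym codes)
                     (code-≤ (λ k → does (x′₊ k ≟ a)) (between a x′₊ y₊))) ⟩
    ℓ′          <⟨ n<1+n ℓ′ ⟩
    1 + ℓ′      ≡⟨ cong (_+ ℓ′) (𝟙-yes (x′ Fin.zero <? a ×-dec a <? y Fin.zero) (x′<a , a<y)) ⟨
    #between a x′ y ≡⟨ eqz ⟨
    #between a x y  ≡⟨ cong (_+ ℓ) (𝟙-no (x Fin.zero <? a ×-dec a <? y Fin.zero)
                                      (λ (lt , _) → <⇒≢ lt x≡a)) ⟩
    ℓ           ∎)
    where
    open ≤-Reasoning
    x₊ = x ∘ Fin.suc
    x′₊ = x′ ∘ Fin.suc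
    y₊ = y ∘ Fin.suc
    ℓ = #between a x₊ y₊
    ℓ′ = #between a x′₊ y₊
    codes : ℓ ∷ rowCode a x₊ y₊ ≡ rowCode a x′₊ y₊
    codes = trans (sym (rowCode-≡ a x y x≡a))
      (trans eqc (rowCode-≢ a x′ y (<⇒≢ x′<a)))

-- If exactly one of the two heads is `suc b` and the other is smaller, `clash` applies, since
-- strictness puts that head over an entry above `suc b`. Otherwise the heads contribute equally to
-- code and count, and both equations pass to the tails.
rowCode-injective : ∀ {m} b (x x′ y : Fin m → ℕ) → (∀ k → x k ⊔ suc b ≡ x′ k ⊔ suc b) →
  (∀ k → x k < y k) → (∀ k → x′ k < y k) →
  rowCode (suc b) x y ≡ rowCode (suc b) x′ y → #between (suc b) x y ≡ #between (suc b) x′ y →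
  ∀ k → x k ⊔ b ≡ x′ k ⊔ b
rowCode-injective {suc m} b x x′ y eq x<y x′<y eqc eqz = goal
  where
  a = suc b

  tails : ∀ k → rowCode a (x ∘ Fin.suc) (y ∘ Fin.suc) ≡ rowCode a (x′ ∘ Fin.suc) (y ∘ Fin.suc) →
          between a x y Fin.zero ≡ between a x′ y Fin.zero →
          x (Fin.suc k) ⊔ b ≡ x′ (Fin.suc k) ⊔ b
  tails k e z = rowCode-injective b (x ∘ Fin.suc) (x′ ∘ Fin.suc) (y ∘ Fin.suc) (eq ∘ Fin.suc)
    (x<y ∘ Fin.suc) (x′<y ∘ Fin.suc) e (between-same b x x′ y z eqz) k

  both-equal : x Fin.zero ≡ x′ Fin.zero → ∀ k → x k ⊔ b ≡ x′ k ⊔ b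
  both-equal e Fin.zero    = cong (_⊔ b) e
  both-equal e (Fin.suc k) = tails k codes (cong (λ v → 𝟙 (v <? a ×-dec a <? y Fin.zero)) e)
    where
    codes : rowCode a (x ∘ Fin.suc) (y ∘ Fin.suc) ≡ rowCode a (x′ ∘ Fin.suc) (y ∘ Fin.suc)
    codes with x Fin.zero ≟ a
    ... | yes p = ∷-injectiveʳ (trans (sym (rowCode-≡ a x y p)) (trans eqc (rowCode-≡ a x′ y (trans (sym e) p))))
    ... | no ne = trans (sym (rowCode-≢ a x y ne)) (trans eqc (rowCode-≢ a x′ y (ne ∘ trans e)))

  both-below : x Fin.zero < a → x′ Fin.zero < a → ∀ k → x k ⊔ b ≡ x′ k ⊔ b
  both-below p q Fin.zero    = trans (m≤n⇒m⊔n≡n (s≤s⁻¹ p)) (sym (m≤n⇒m⊔n≡n (s≤s⁻¹ q)))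
  both-below p q (Fin.suc k) = tails k
    (trans (sym (rowCode-≢ a x y (<⇒≢ p))) (trans eqc (rowCode-≢ a x′ y (<⇒≢ q))))
    (𝟙-cong (x Fin.zero <? a ×-dec a <? y Fin.zero) (x′ Fin.zero <? a ×-dec a <? y Fin.zero)
      (λ (_ , r) → q , r) (λ (_ , r) → p , r))

  goal : ∀ k → x k ⊔ b ≡ x′ k ⊔ b
  goal with ≡⊎≤ a (x Fin.zero) (x′ Fin.zero) (eq Fin.zero)
  ... | inj₁ e = both-equal e
  ... | inj₂ (p , q) with m≤n⇒m<n∨m≡n p | m≤n⇒m<n∨m≡n q
  ...   | inj₁ lt | inj₁ lt′ = both-below lt lt′
  ...   | inj₂ e  | inj₂ e′  = both-equal (trans e (sym e′))
  ...   | inj₂ e  | inj₁ lt′ = contradiction eqz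
    (clash b x x′ y e lt′ (subst (_< y Fin.zero) e (x<y Fin.zero)) eqc)
  ...   | inj₁ lt | inj₂ e′  = contradiction (sym eqz)
    (clash b x′ x y e′ lt (subst (_< y Fin.zero) e′ (x′<y Fin.zero)) (sym eqc))

-- Rows of a filling and their zcounts.

module _ {n : ℕ} {lam : Partition n} where

  rowCell-≡ : ∀ r {c d} .(p : c < part lam r) .(q : d < part lam r) → c ≡ d →
              _≡_ {A = Cell lam} (cell r c p) (cell r d q)
  rowCell-≡ r p q refl = refl

  rowCell-η : ∀ r c .(p : c < part lam r) → rowCell lam r (fromℕ< p) ≡ cell r c p
  rowCell-η r c p = rowCell-≡ r _ _ (Fin.toℕ-fromℕ< p)

  maybe-below : ∀ {A : Set} (q : Cell lam → A) d r k →
                maybe′ q d (below (rowCell lam r k)) ≡ extend d (q ∘ rowCell lam (suc r)) k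
  maybe-below q d r k with toℕ k <? part lam (suc r)
  ... | yes p = trans (cong q (sym (rowCell-η (suc r) (toℕ k) p))) (sym (extend-< d _ k p))
  ... | no ¬p = sym (extend-≥ d _ k (≮⇒≥ ¬p))

  ∑-rowCells-below : ∀ r (q : Cell lam → ℕ) →
                     ∑ (rowCells lam r) (maybe′ q 0 ∘ below) ≡ ∑ (rowCells lam (suc r)) q
  ∑-rowCells-below r q = begin
    ∑ (rowCells lam r) (maybe′ q 0 ∘ below)         ≡⟨ ∑-tabulate (rowCell lam r) _ ⟩
    ∑ᶠ (maybe′ q 0 ∘ below ∘ rowCell lam r)         ≡⟨ ∑ᶠ-cong (maybe-below q 0 r) ⟩
    ∑ᶠ {part lam r} (extend 0 (q ∘ rowCell lam (suc r)))  ≡⟨ ∑ᶠ-extend (decreasing lam r) _ ⟩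
    ∑ᶠ (q ∘ rowCell lam (suc r))                    ≡⟨ ∑-tabulate (rowCell lam (suc r)) q ⟨
    ∑ (rowCells lam (suc r)) q                      ∎
    where open ≡-Reasoning

  module _ (F : CSF lam) where

    -- All entries are below `n`, so `n` serves as the infinite entry outside the diagram.
    rowOf belowOf : (i : ℕ) → Fin (part lam i) → ℕ
    rowOf i k   = toℕ (entry F (rowCell lam i k))
    belowOf i   = extend n (rowOf (suc i))

    rowOf-< : ∀ i k → rowOf i k < n
    rowOf-< i k = Fin.toℕ<n (entry F (rowCell lam i k))

    -- Each step down a column raises the entry by at least one.
    entry-≥ : ∀ u → row u ≤ toℕ (entry F u)
    entry-≥ (cell r c p) = go r p
      where
      go : ∀ r .(p : c < part lam r) → r ≤ toℕ (entry F (cell r c p))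
      go zero p = z≤n
      go (suc r) p =
        ≤-<-trans (go r (<-≤-trans p (decreasing lam r))) (strict F _ _ refl (n<1+n r))

    rowOf<belowOf : ∀ i k → rowOf i k < belowOf i k
    rowOf<belowOf i k with toℕ k <? part lam (suc i)
    ... | yes p = subst (rowOf i k <_) (sym (extend-< n (rowOf (suc i)) k p))
      (strict F _ _ (sym (Fin.toℕ-fromℕ< p)) (n<1+n i))
    ... | no ¬p = subst (rowOf i k <_) (sym (extend-≥ n (rowOf (suc i)) k (≮⇒≥ ¬p))) (rowOf-< i k)

    #≤-rowOf : ∀ i j → #≤ F i j ≡ #≤ᶠ (rowOf i) j
    #≤-rowOf i j = begin
      length (filter (λ a → toℕ a ≤? j) (sortedRow F i))
        ≡⟨ ↭-length (filter-↭ (λ a → toℕ a ≤? j) (Sort.sort-↭ (Fin.≤-decTotalOrder n) _)) ⟩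
      length (filter (λ a → toℕ a ≤? j) (map (entry F) (rowCells lam i)))
        ≡⟨ length-filter-∑ (λ a → toℕ a ≤? j) (map (entry F) (rowCells lam i)) ⟩
      ∑ (map (entry F) (rowCells lam i)) (λ a → 𝟙 (toℕ a ≤? j))
        ≡⟨ cong (λ xs → ∑ xs (λ a → 𝟙 (toℕ a ≤? j))) (map-tabulate (rowCell lam i) (entry F)) ⟩
      ∑ (tabulate (entry F ∘ rowCell lam i)) (λ a → 𝟙 (toℕ a ≤? j))
        ≡⟨ ∑-tabulate (entry F ∘ rowCell lam i) _ ⟩
      #≤ᶠ (rowOf i) j ∎
      where open ≡-Reasoning

    -- A cell over an entry at most `suc j` has entry at most `j`; the remaining cells with entry at
    -- most `j` are the ones in between. The additive form allows cancellation when two fillings are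
    -- compared.
    #between-SE : ∀ i j → suc j < n →
                  #between (suc j) (rowOf i) (belowOf i) + #≤ F (suc i) (suc j) ≡ #≤ F i j
    #between-SE i j 1+j<n = begin
      #between (suc j) (rowOf i) (belowOf i) + #≤ F (suc i) (suc j)
        ≡⟨ cong (#between (suc j) (rowOf i) (belowOf i) +_)
             (trans (#≤-rowOf (suc i) (suc j))
               (sym (#≤ᶠ-extend (decreasing lam i) (rowOf (suc i)) (suc j) 1+j<n))) ⟩
      #between (suc j) (rowOf i) (belowOf i) + #≤ᶠ (belowOf i) (suc j)
        ≡⟨ ∑ᶠ-split j (suc j) (rowOf i) (belowOf i) (λ k y≤a → s≤s⁻¹ (<-≤-trans (rowOf<belowOf i k) y≤a)) ⟩
      #≤ᶠ (rowOf i) j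
        ≡⟨ #≤-rowOf i j ⟨
      #≤ F i j ∎
      where open ≡-Reasoning

    private
      below-< : ∀ c m → Maybe.All (λ y → entry F c Fin.< entry F y) m →
                toℕ (entry F c) < maybe′ (toℕ ∘ entry F) n m
      below-< c (just y) (Maybe.just lt) = lt
      below-< c nothing  Maybe.nothing   = Fin.toℕ<n (entry F c)

      below-<⁻ : ∀ c m → toℕ (entry F c) < maybe′ (toℕ ∘ entry F) n m →
                 Maybe.All (λ y → entry F c Fin.< entry F y) m
      below-<⁻ c (just y) lt = Maybe.just lt
      below-<⁻ c nothing  _  = Maybe.nothing

    Between⇒ : ∀ c i l → Between F c (rowCell lam i l) →
               rowOf i l < toℕ (entry F c) × toℕ (entry F c) < belowOf i l
    Between⇒ c i l (lt , b) =
      lt , subst (toℕ (entry F c) <_) (maybe-below _ n i l) (below-< c _ b)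

    Between⇐ : ∀ c i l → rowOf i l < toℕ (entry F c) × toℕ (entry F c) < belowOf i l →
               Between F c (rowCell lam i l)
    Between⇐ c i l (lt , b) =
      lt , below-<⁻ c _ (subst (toℕ (entry F c) <_) (sym (maybe-below _ n i l)) b)

    zcountˡ-before : ∀ i k → zcountˡ F (rowCell lam i k)
                             ≡ before (between (rowOf i k) (rowOf i) (belowOf i)) k
    zcountˡ-before i k = begin
      zcountˡ F c
        ≡⟨ length-filter-∑ (λ x → col x <? toℕ k ×-dec between? F c x) (rowCells lam i) ⟩
      ∑ (rowCells lam i) (λ x → 𝟙 (col x <? toℕ k ×-dec between? F c x))
        ≡⟨ ∑-tabulate (rowCell lam i) _ ⟩
      ∑ᶠ (λ l → 𝟙 (toℕ l <? toℕ k ×-dec between? F c (rowCell lam i l)))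
        ≡⟨ ∑ᶠ-cong (λ l → 𝟙-cong
             (toℕ l <? toℕ k ×-dec between? F c (rowCell lam i l)) (toℕ l <? toℕ k ×-dec btw? l)
             (λ (p , b) → p , Between⇒ c i l b) (λ (p , b) → p , Between⇐ c i l b)) ⟩
      ∑ᶠ (λ l → 𝟙 (toℕ l <? toℕ k ×-dec btw? l))
        ≡⟨ ∑ᶠ-before btw? k ⟩
      before (between (rowOf i k) (rowOf i) (belowOf i)) k ∎
      where
      open ≡-Reasoning
      c = rowCell lam i k
      btw? = λ l → rowOf i l <? rowOf i k ×-dec rowOf i k <? belowOf i l

    zcountʳ-after : ∀ i k → zcountʳ F (rowCell lam i k)
                             ≡ after (between (rowOf i k) (rowOf i) (belowOf i)) k
    zcountʳ-after i k = begin
      zcountʳ F c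
        ≡⟨ length-filter-∑ (λ x → toℕ k <? col x ×-dec between? F c x) (rowCells lam i) ⟩
      ∑ (rowCells lam i) (λ x → 𝟙 (toℕ k <? col x ×-dec between? F c x))
        ≡⟨ ∑-tabulate (rowCell lam i) _ ⟩
      ∑ᶠ (λ l → 𝟙 (toℕ k <? toℕ l ×-dec between? F c (rowCell lam i l)))
        ≡⟨ ∑ᶠ-cong (λ l → 𝟙-cong
             (toℕ k <? toℕ l ×-dec between? F c (rowCell lam i l)) (toℕ k <? toℕ l ×-dec btw? l)
             (λ (p , b) → p , Between⇒ c i l b) (λ (p , b) → p , Between⇐ c i l b)) ⟩
      ∑ᶠ (λ l → 𝟙 (toℕ k <? toℕ l ×-dec btw? l))
        ≡⟨ ∑ᶠ-after btw? k ⟩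
      after (between (rowOf i k) (rowOf i) (belowOf i)) k ∎
      where
      open ≡-Reasoning
      c = rowCell lam i k
      btw? = λ l → rowOf i l <? rowOf i k ×-dec rowOf i k <? belowOf i l

    overlay-rowCode : ∀ i j → map (zcountʳ F) (cellsWith F i j) ≡ rowCode (suc j) (rowOf i) (belowOf i)
    overlay-rowCode i j = map-filter-tabulate (λ c → toℕ (entry F c) ≟ suc j) (zcountʳ F)
      (rowCell lam i) (between (suc j) (rowOf i) (belowOf i))
      (λ k e → trans (zcountʳ-after i k) (cong (λ a → after (between a (rowOf i) (belowOf i)) k) e))

    -- Strict comparison keeps a cell from being counted for its own value, so the two sides exhaust
    -- `#between`.
    zcountˡ≡SE∸zcountʳ : ∀ i j → suc j < n → ∀ k → rowOf i k ≡ suc j →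
      zcountˡ F (rowCell lam i k) ≡ (#≤ F i j ∸ #≤ F (suc i) (suc j)) ∸ zcountʳ F (rowCell lam i k)
    zcountˡ≡SE∸zcountʳ i j 1+j<n k e = begin
      zˡ                                ≡⟨ m+n∸n≡m zˡ zʳ ⟨
      (zˡ + zʳ) ∸ zʳ                    ≡⟨ cong (_∸ zʳ) (begin
        zˡ + zʳ                         ≡⟨ cong₂ _+_ (zcountˡ-before i k) (zcountʳ-after i k) ⟩
        before (btw (rowOf i k)) k + after (btw (rowOf i k)) k
          ≡⟨ before+after (btw (rowOf i k)) k
               (𝟙-no (rowOf i k <? rowOf i k ×-dec rowOf i k <? belowOf i k) (λ (lt , _) → <-irrefl refl lt)) ⟩
        #between (rowOf i k) (rowOf i) (belowOf i)
          ≡⟨ cong (λ a → #between a (rowOf i) (belowOf i)) e ⟩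
        #between (suc j) (rowOf i) (belowOf i)
          ≡⟨ m+n∸n≡m _ (#≤ F (suc i) (suc j)) ⟨
        #between (suc j) (rowOf i) (belowOf i) + #≤ F (suc i) (suc j) ∸ #≤ F (suc i) (suc j)
          ≡⟨ cong (_∸ #≤ F (suc i) (suc j)) (#between-SE i j 1+j<n) ⟩
        #≤ F i j ∸ #≤ F (suc i) (suc j) ∎) ⟩
      (#≤ F i j ∸ #≤ F (suc i) (suc j)) ∸ zʳ ∎
      where
      open ≡-Reasoning
      btw = λ a → between a (rowOf i) (belowOf i)
      zˡ = zcountˡ F (rowCell lam i k)
      zʳ = zcountʳ F (rowCell lam i k)

    -- Reading the left counts from right to left supplies the reversal built into `complement`.
    ψ-quinv≈boxcomp : ψ-quinv F ≈ᴾ boxcomp (ψ-inv F)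
    ψ-quinv≈boxcomp = (λ _ _ _ _ → refl) , λ i j _ 1+j<n → begin
      map (zcountˡ F) (reverse (cellsWith F i j))
        ≡⟨ reverse-map (zcountˡ F) (cellsWith F i j) ⟩
      reverse (map (zcountˡ F) (cellsWith F i j))
        ≡⟨ cong reverse (map-cong-local (complementary i j 1+j<n)) ⟩
      reverse (map ((#≤ F i j ∸ #≤ F (suc i) (suc j) ∸_) ∘ zcountʳ F) (cellsWith F i j))
        ≡⟨ cong reverse (map-∘ (cellsWith F i j)) ⟩
      reverse (map (#≤ F i j ∸ #≤ F (suc i) (suc j) ∸_) (map (zcountʳ F) (cellsWith F i j))) ∎
      where
      open ≡-Reasoning
      complementary : ∀ i j → suc j < n →
        All (λ c → zcountˡ F c ≡ (#≤ F i j ∸ #≤ F (suc i) (suc j)) ∸ zcountʳ F c) (cellsWith F i j)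
      complementary i j 1+j<n = All.zipWith (λ (h , e) → h e)
        ( All.filter⁺ (λ c → toℕ (entry F c) ≟ suc j)
            (All.tabulate⁺
              {P = λ c → toℕ (entry F c) ≡ suc j →
                         zcountˡ F c ≡ (#≤ F i j ∸ #≤ F (suc i) (suc j)) ∸ zcountʳ F c}
              {f = rowCell lam i} (zcountˡ≡SE∸zcountʳ i j 1+j<n))
        , All.all-filter (λ c → toℕ (entry F c) ≟ suc j) (rowCells lam i))

  entry-rowOf : ∀ {F G : CSF lam} → (∀ i k → rowOf F i k ≡ rowOf G i k) → F ≈ G
  entry-rowOf {F} {G} e (cell r c p) = Fin.toℕ-injective (begin
    toℕ (entry F (cell r c p)) ≡⟨ cong (toℕ ∘ entry F) (rowCell-η r c p) ⟨
    rowOf F r (fromℕ< p)       ≡⟨ e r (fromℕ< p) ⟩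
    rowOf G r (fromℕ< p)       ≡⟨ cong (toℕ ∘ entry G) (rowCell-η r c p) ⟩
    toℕ (entry G (cell r c p)) ∎)
    where open ≡-Reasoning

  -- Pointwise equality of overlaid patterns and the box complement.

  ≈ᴾ-setoid : Setoid 0ℓ 0ℓ
  ≈ᴾ-setoid = record
    { Carrier       = POP lam
    ; _≈_           = _≈ᴾ_
    ; isEquivalence = record
      { refl  = (λ _ _ _ _ → refl) , (λ _ _ _ _ → refl)
      ; sym   = λ (p , o) → (λ i j a b → sym (p i j a b)) , (λ i j a b → sym (o i j a b))
      ; trans = λ (p , o) (p′ , o′) →
          (λ i j a b → trans (p i j a b) (p′ i j a b)) , (λ i j a b → trans (o i j a b) (o′ i j a b))
      }
    }

  ψ-inv-cong : {F G : CSF lam} → F ≈ G → ψ-inv F ≈ᴾ ψ-inv G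
  ψ-inv-cong {F} {G} e =
    (λ i j _ _ → trans (#≤-rowOf F i j) (trans (#≤ᶠ-cong j (rows i)) (sym (#≤-rowOf G i j)))) ,
    (λ i j _ _ → trans (overlay-rowCode F i j) (trans
      (rowCode-cong (suc j) (rows i) (extend-cong n (rows (suc i)))) (sym (overlay-rowCode G i j))))
    where
    rows : ∀ i k → rowOf F i k ≡ rowOf G i k
    rows i k = cong toℕ (e (rowCell lam i k))

  SE-cong : ∀ {P Q : POP lam} → P ≈ᴾ Q → ∀ i j (i≤j : i ≤ j) (1+j<n : suc j < n) →
            SE (array (pattern′ P)) i j i≤j 1+j<n ≡ SE (array (pattern′ Q)) i j i≤j 1+j<n
  SE-cong (p , _) i j i≤j 1+j<n =
    cong₂ _∸_ (p i j i≤j (<-trans (n<1+n j) 1+j<n)) (p (suc i) (suc j) (s≤s i≤j) 1+j<n)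

  boxcomp-cong : {P Q : POP lam} → P ≈ᴾ Q → boxcomp P ≈ᴾ boxcomp Q
  boxcomp-cong {P} {Q} e@(p , o) =
    p , λ i j i≤j 1+j<n → cong₂ complement (SE-cong {P} {Q} e i j i≤j 1+j<n) (o i j i≤j 1+j<n)

  complement-involutive : ∀ {ℓ π} → All (_≤ ℓ) π → complement ℓ (complement ℓ π) ≡ π
  complement-involutive {ℓ} {π} ps = begin
    reverse (map (ℓ ∸_) (reverse (map (ℓ ∸_) π))) ≡⟨ cong reverse (reverse-map (ℓ ∸_) (map (ℓ ∸_) π)) ⟩
    reverse (reverse (map (ℓ ∸_) (map (ℓ ∸_) π))) ≡⟨ reverse-involutive _ ⟩
    map (ℓ ∸_) (map (ℓ ∸_) π)                     ≡⟨ map-∘ π ⟨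
    map (λ v → ℓ ∸ (ℓ ∸ v)) π                     ≡⟨ map-id-local (All.map m∸[m∸n]≡n ps) ⟩
    π                                             ∎
    where open ≡-Reasoning

  boxcomp-involutive : (P : POP lam) → boxcomp (boxcomp P) ≈ᴾ P
  boxcomp-involutive P = (λ _ _ _ _ → refl) ,
    λ i j i≤j 1+j<n → complement-involutive (bounded (inBox P i j i≤j 1+j<n))

-- Injectivity of `ψ-inv`.

module _ {n : ℕ} {lam : Partition n} where

  ¬row≥n : ∀ {i} → n ≤ i → ¬ Fin (part lam i)
  ¬row≥n {i} n≤i = Fin.¬Fin0 ∘ subst Fin (finite lam i n≤i)

  module _ {F G : CSF lam} (ψ≈ : ψ-inv F ≈ᴾ ψ-inv G) where

    private
      #≤-same = proj₁ ψ≈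

      -- Downward induction on `b`, with `d` the distance to `n - 1`. Capped at `n - 1` all entries
      -- look alike; each step settles the cells holding `suc b` from the overlay at `i`, `b`, the
      -- row beneath being known.
      capped : ∀ i → (∀ k → rowOf F (suc i) k ≡ rowOf G (suc i) k) →
               ∀ d b → i ≤ b → d + suc b ≡ n → ∀ k → rowOf F i k ⊔ b ≡ rowOf G i k ⊔ b
      capped i rows⁺ zero b i≤b refl k = trans
        (m≤n⇒m⊔n≡n (s≤s⁻¹ (rowOf-< F i k))) (sym (m≤n⇒m⊔n≡n (s≤s⁻¹ (rowOf-< G i k))))
      capped i rows⁺ (suc d) b i≤b eq =
        rowCode-injective b (rowOf F i) (rowOf G i) (belowOf F i)
          (capped i rows⁺ d (suc b) (m≤n⇒m≤1+n i≤b) (trans (+-suc d (suc b)) eq))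
          (rowOf<belowOf F i)
          (λ k → subst (rowOf G i k <_) (sym (y≡ k)) (rowOf<belowOf G i k))
          (begin
            rowCode (suc b) (rowOf F i) (belowOf F i) ≡⟨ overlay-rowCode F i b ⟨
            map (zcountʳ F) (cellsWith F i b)         ≡⟨ proj₂ ψ≈ i b i≤b 1+b<n ⟩
            map (zcountʳ G) (cellsWith G i b)         ≡⟨ overlay-rowCode G i b ⟩
            rowCode (suc b) (rowOf G i) (belowOf G i)
              ≡⟨ rowCode-cong (suc b) {rowOf G i} (λ _ → refl) (sym ∘ y≡) ⟩
            rowCode (suc b) (rowOf G i) (belowOf F i) ∎)
          (+-cancelʳ-≡ (#≤ F (suc i) (suc b)) _ _ (begin
            #between (suc b) (rowOf F i) (belowOf F i) + #≤ F (suc i) (suc b)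
              ≡⟨ #between-SE F i b 1+b<n ⟩
            #≤ F i b
              ≡⟨ #≤-same i b i≤b (<-trans (n<1+n b) 1+b<n) ⟩
            #≤ G i b
              ≡⟨ #between-SE G i b 1+b<n ⟨
            #between (suc b) (rowOf G i) (belowOf G i) + #≤ G (suc i) (suc b)
              ≡⟨ cong₂ _+_ (#between-cong (suc b) {rowOf G i} (λ _ → refl) (sym ∘ y≡))
                   (sym (#≤-same (suc i) (suc b) (s≤s i≤b) 1+b<n)) ⟩
            #between (suc b) (rowOf G i) (belowOf F i) + #≤ F (suc i) (suc b) ∎))
        where
        open ≡-Reasoning
        y≡ : ∀ k → belowOf F i k ≡ belowOf G i k
        y≡ = extend-cong n rows⁺
        1+b<n : suc b < n
        1+b<n = subst (suc b <_) eq (s≤s (m≤n+m (suc b) d))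

      -- Induction from the empty rows upwards; by `entry-≥`, capping row `i` at `i` loses nothing.
      rows : ∀ d i → n ≤ d + i → ∀ k → rowOf F i k ≡ rowOf G i k
      rows d i n≤d+i k with ≤-<-connex n i
      rows d       i n≤d+i k | inj₁ n≤i = contradiction k (¬row≥n n≤i)
      rows zero    i n≤i   k | inj₂ i<n = contradiction n≤i (<⇒≱ i<n)
      rows (suc d) i n≤d+i k | inj₂ i<n = begin
        rowOf F i k     ≡⟨ m≥n⇒m⊔n≡m (entry-≥ F (rowCell lam i k)) ⟨
        rowOf F i k ⊔ i ≡⟨ capped i (rows d (suc i) (subst (n ≤_) (sym (+-suc d i)) n≤d+i))
                             (n ∸ suc i) i ≤-refl (m∸n+n≡m i<n) k ⟩
        rowOf G i k ⊔ i ≡⟨ m≥n⇒m⊔n≡m (entry-≥ G (rowCell lam i k)) ⟩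
        rowOf G i k     ∎
        where open ≡-Reasoning

    ψ-inv-injective : F ≈ G
    ψ-inv-injective = entry-rowOf {F = F} {G} λ i k → rows n i (m≤m+n n i) k

  -- Surjectivity of `ψ-inv`: building the filling of a given pattern.

  module _ (P : POP lam) where

    private
      T : Array n
      T = array (pattern′ P)

    -- The row above relies on two of these fields: `counts` gives its number of free cells, and
    -- `≥row` leaves room for its least value.
    record Row (i : ℕ) : Set where
      field
        values : Fin (part lam i) → ℕ
        ≥row   : ∀ k → i ≤ values k
        <n     : ∀ k → values k < n
        counts : ∀ j (i≤j : i ≤ j) (j<n : j < n) → #≤ᶠ values j ≡ T i j i≤j j<n

    open Row

    record Above {i : ℕ} (R : Row i) (R⁺ : Row (suc i)) : Set where
      field
        above : ∀ k → values R k < extend n (values R⁺) k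
        codes : ∀ j (i≤j : i ≤ j) (1+j<n : suc j < n) →
                rowCode (suc j) (values R) (extend n (values R⁺)) ≡ overlay P i j i≤j 1+j<n

    open Above

    module _ {i : ℕ} (i<n : i < n) (R⁺ : Row (suc i)) where

      private
        y : Fin (part lam i) → ℕ
        y = extend n (values R⁺)

        i<y : ∀ k → i < y k
        i<y = extend-elim (i <_) i<n (≥row R⁺)

        #≤y : ∀ j (i≤j : i ≤ j) (1+j<n : suc j < n) → #≤ᶠ y (suc j) ≡ T (suc i) (suc j) (s≤s i≤j) 1+j<n
        #≤y j i≤j 1+j<n =
          trans (#≤ᶠ-extend (decreasing lam i) (values R⁺) (suc j) 1+j<n) (counts R⁺ (suc j) (s≤s i≤j) 1+j<n)

        -- The row with its entries below b still unknown and replaced by b.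
        record Stage (b : ℕ) : Set where
          field
            x       : Fin (part lam i) → ℕ
            b≤x     : ∀ k → b ≤ x k
            x<n     : ∀ k → x k < n
            x<y     : ∀ k → b < x k → x k < y k
            #≤x     : ∀ j → b ≤ j → (i≤j : i ≤ j) (j<n : j < n) → #≤ᶠ x j ≡ T i j i≤j j<n
            codes-x : ∀ j → b ≤ j → (i≤j : i ≤ j) (1+j<n : suc j < n) →
                      rowCode (suc j) x y ≡ overlay P i j i≤j 1+j<n

        open Stage

        -- `refine` distributes `suc b` as the overlay prescribes. Capping the result at `suc b`
        -- gives back the old row, so counts and codes of larger values are inherited.
        next : ∀ b → i ≤ b → (1+b<n : suc b < n) → Stage (suc b) → Stage b
        next b i≤b 1+b<n S = record
          { x       = x′
          ; b≤x     = Refinement.b≤ R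
          ; x<n     = λ k → ≤-<-trans (subst (x′ k ≤_) (refines k) (m≤m⊔n (x′ k) a)) (x<n S k)
          ; x<y     = Refinement.fits R
          ; #≤x     = λ j b≤j i≤j j<n → #≤x′ j i≤j j<n (m≤n⇒m<n∨m≡n b≤j)
          ; codes-x = λ j b≤j i≤j 1+j<n → codes-x′ j i≤j 1+j<n (m≤n⇒m<n∨m≡n b≤j)
          }
          where
          open ≡-Reasoning
          a = suc b
          b<n = <-trans (n<1+n b) 1+b<n
          π = overlay P i b i≤b 1+b<n
          ne = NE T i b i≤b 1+b<n
          se = SE T i b i≤b 1+b<n
          Tib Tia T⁺a : ℕ
          Tib = T i b i≤b b<n
          Tia = T i a (m≤n⇒m≤1+n i≤b) 1+b<n
          T⁺a = T (suc i) a (s≤s i≤b) 1+b<n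
          box = inBox P i b i≤b 1+b<n

          sorted-box : ∀ {ℓ π} → All (_≤ ℓ) π → Linked _≥_ π → Linked _≥_ (ℓ ∷ π)
          sorted-box []      _  = [-]
          sorted-box (p ∷ _) ps = p ∷ ps

          y≤a⇒x≤a : ∀ k → y k ≤ a → x S k ≤ a
          y≤a⇒x≤a k y≤a = ≮⇒≥ λ a<x → <-irrefl refl (<-≤-trans (<-trans a<x (x<y S k a<x)) y≤a)

          -- `Tib` cancels from NE + SE. What remains compares the cells with entry at most `a` with
          -- those over an entry at most `a`, and the difference is the free cells.
          size : length π + se ≡ ∑ᶠ (free a (x S) y)
          size = begin
            length π + se              ≡⟨ cong (_+ se) (length≡ box) ⟩
            ne + se                    ≡⟨ +-∸-assoc ne (SE≥0 (pattern′ P) i b i≤b 1+b<n) ⟨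
            Tia ∸ Tib + Tib ∸ T⁺a      ≡⟨ cong (_∸ T⁺a) (m∸n+n≡m (NE≥0 (pattern′ P) i b i≤b 1+b<n)) ⟩
            Tia ∸ T⁺a                  ≡⟨ cong₂ _∸_ (#≤x S a ≤-refl (m≤n⇒m≤1+n i≤b) 1+b<n)
                                                    (#≤y b i≤b 1+b<n) ⟨
            #≤ᶠ (x S) a ∸ #≤ᶠ y a      ≡⟨ cong (_∸ #≤ᶠ y a) (∑ᶠ-split a a (x S) y y≤a⇒x≤a) ⟨
            ∑ᶠ (free a (x S) y) + #≤ᶠ y a ∸ #≤ᶠ y a ≡⟨ m+n∸n≡m _ (#≤ᶠ y a) ⟩
            ∑ᶠ (free a (x S) y)        ∎

          R : Refinement b (x S) y π se
          R = refine b (x S) y π se (b≤x S) (x<y S) (sorted-box (bounded box) (sorted box)) size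

          open Refinement R using (refines; fits; code≡; between≡) renaming (revealed to x′)

          y≤a⇒x′≤b : ∀ k → y k ≤ a → x′ k ≤ b
          y≤a⇒x′≤b k y≤a = ≮⇒≥ λ b<x′ → <-irrefl refl (<-≤-trans (fits k b<x′) (≤-trans y≤a b<x′))

          #≤x′ : ∀ j (i≤j : i ≤ j) (j<n : j < n) → b < j ⊎ b ≡ j → #≤ᶠ x′ j ≡ T i j i≤j j<n
          #≤x′ j i≤j j<n (inj₁ b<j) = begin
            #≤ᶠ x′ j                ≡⟨ #≤ᶠ-⊔ b<j x′ ⟨
            #≤ᶠ (λ k → x′ k ⊔ a) j  ≡⟨ #≤ᶠ-cong j refines ⟩
            #≤ᶠ (x S) j             ≡⟨ #≤x S j b<j i≤j j<n ⟩
            T i j i≤j j<n           ∎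
          #≤x′ .b i≤j j<n (inj₂ refl) = begin
            #≤ᶠ x′ b                ≡⟨ ∑ᶠ-split b a x′ y y≤a⇒x′≤b ⟨
            #between a x′ y + #≤ᶠ y a ≡⟨ cong₂ _+_ between≡ (#≤y b i≤b 1+b<n) ⟩
            se + T⁺a                ≡⟨ m∸n+n≡m (SE≥0 (pattern′ P) i b i≤b 1+b<n) ⟩
            Tib                     ∎

          codes-x′ : ∀ j (i≤j : i ≤ j) (1+j<n : suc j < n) → b < j ⊎ b ≡ j →
                     rowCode (suc j) x′ y ≡ overlay P i j i≤j 1+j<n
          codes-x′ j i≤j 1+j<n (inj₁ b<j) = begin
            rowCode (suc j) x′ y                ≡⟨ rowCode-⊔ (s≤s b<j) x′ y ⟨
            rowCode (suc j) (λ k → x′ k ⊔ a) y  ≡⟨ rowCode-cong (suc j) {y = y} refines (λ _ → refl) ⟩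
            rowCode (suc j) (x S) y             ≡⟨ codes-x S j b<j i≤j 1+j<n ⟩
            overlay P i j i≤j 1+j<n             ∎
          codes-x′ .b i≤j 1+j<n (inj₂ refl) = code≡

        stage : ∀ d b → i ≤ b → d + suc b ≡ n → Stage b
        -- Here `b` is `n - 1`: every cell shows the placeholder, the only count is the row length
        -- fixed by `top`, and no code is required yet.
        stage zero b i≤b 1+b≡n = record
          { x       = λ _ → b
          ; b≤x     = λ _ → ≤-refl
          ; x<n     = λ _ → ≤-reflexive 1+b≡n
          ; x<y     = λ _ b<b → contradiction b<b (<-irrefl refl)
          ; #≤x     = λ j b≤j i≤j j<n → trans
              (∑ᶠ-1 {part lam i} (λ _ → 𝟙-yes (b ≤? j) b≤j))
              (sym (top (pattern′ P) i j i≤j j<n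
                (≤-antisym j<n (subst (_≤ suc j) 1+b≡n (s≤s b≤j)))))
          ; codes-x = λ j b≤j i≤j 1+j<n →
              contradiction (subst (_≤ suc j) 1+b≡n (s≤s b≤j)) (<⇒≱ 1+j<n)
          }
        stage (suc d) b i≤b eq =
          next b i≤b (subst (suc b <_) eq (s≤s (m≤n+m (suc b) d)))
            (stage d (suc b) (m≤n⇒m≤1+n i≤b) (trans (+-suc d (suc b)) eq))

        final : Stage i
        final = stage (n ∸ suc i) i ≤-refl (m∸n+n≡m i<n)

      rowAbove : Σ[ R ∈ Row i ] Above R R⁺
      rowAbove = record
        { values = x final
        ; ≥row   = b≤x final
        ; <n     = x<n final
        ; counts = λ j i≤j j<n → #≤x final j i≤j i≤j j<n
        } , record
        { above = λ k → fits k (m≤n⇒m<n∨m≡n (b≤x final k))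
        ; codes = λ j i≤j 1+j<n → codes-x final j i≤j i≤j 1+j<n
        }
        where
        fits : ∀ k → i < x final k ⊎ i ≡ x final k → x final k < y k
        fits k (inj₁ i<x) = x<y final k i<x
        -- A cell still showing the placeholder now holds `i`, and everything beneath it is at least
        -- `i + 1`.
        fits k (inj₂ i≡x) = subst (_< y k) i≡x (i<y k)

    emptyRow : ∀ i → n ≤ i → Row i
    emptyRow i n≤i = record
      { values = λ k → contradiction k (¬row≥n n≤i)
      ; ≥row   = λ k → contradiction k (¬row≥n n≤i)
      ; <n     = λ k → contradiction k (¬row≥n n≤i)
      ; counts = λ j i≤j j<n → contradiction (<-≤-trans j<n n≤i) (≤⇒≯ i≤j)
      }

    private
      build : ∀ d i → n ≡ d + i → Row i
      build zero    i eq = emptyRow i (≤-reflexive eq)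
      build (suc d) i eq = proj₁ (rowAbove (subst (i <_) (sym eq) (s≤s (m≤n+m i d)))
        (build d (suc i) (trans eq (sym (+-suc d i)))))

      -- `build` takes a proof about its index; identifying the two proofs for the lower row makes
      -- both rows come from one call of `rowAbove`.
      build-above : ∀ d i (eq : n ≡ suc d + i) (eq′ : n ≡ d + suc i) →
                    Above (build (suc d) i eq) (build d (suc i) eq′)
      build-above d i eq eq′ with ≡-irrelevant eq′ (trans eq (sym (+-suc d i)))
      ... | refl = proj₂ (rowAbove _ _)

    -- The bound is irrelevant because it is derived from the irrelevant column bound of a cell.
    rowAt : ∀ i → .(i ≤ n) → Row i
    rowAt i i≤n = build (n ∸ i) i (sym (m∸n+n≡m (recompute (i ≤? n) i≤n)))

    rowAt-above : ∀ i (i<n : i < n) → Above (rowAt i (<⇒≤ i<n)) (rowAt (suc i) i<n)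
    rowAt-above i i<n = go (n ∸ i) (+-∸-assoc 1 i<n) _
      where
      go : ∀ d → d ≡ suc (n ∸ suc i) → (eq : n ≡ d + i) → Above (build d i eq) (rowAt (suc i) i<n)
      go .(suc (n ∸ suc i)) refl eq = build-above (n ∸ suc i) i eq _

    private
      row<n : ∀ {c r} → .(c < part lam r) → r < n
      row<n {c} {r} p = ≰⇒> λ n≤r → ¬row≥n n≤r (fromℕ< p)

      value : Cell lam → ℕ
      value (cell r c p) = values (rowAt r (<⇒≤ (row<n p))) (fromℕ< p)

      value-adjacent : ∀ r c .(p : c < part lam r) .(q : c < part lam (suc r)) →
                       value (cell r c p) < value (cell (suc r) c q)
      value-adjacent r c p q = subst (values R (fromℕ< p) <_)
        (trans (extend-< n (values R⁺) (fromℕ< p) c<l)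
          (cong (values R⁺) (Fin.fromℕ<-cong _ _ (Fin.toℕ-fromℕ< p) c<l q)))
        (above (rowAt-above r (row<n p)) (fromℕ< p))
        where
        R = rowAt r (<⇒≤ (row<n p))
        R⁺ = rowAt (suc r) (row<n p)
        c<l : toℕ (fromℕ< p) < part lam (suc r)
        c<l = subst (_< part lam (suc r)) (sym (Fin.toℕ-fromℕ< p))
          (recompute (c <? part lam (suc r)) q)

      value-strict : ∀ r s c .(p : c < part lam r) .(q : c < part lam s) → r < s →
                     value (cell r c p) < value (cell s c q)
      value-strict r (suc s) c p q r<1+s with m≤n⇒m<n∨m≡n (s≤s⁻¹ r<1+s)
      ... | inj₂ refl = value-adjacent r c p q
      ... | inj₁ r<s  = <-trans (value-strict r s c p _ r<s)
        (value-adjacent s c (<-≤-trans q (decreasing lam s)) q)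

      value-<n : ∀ u → value u < n
      value-<n (cell r c p) = <n (rowAt r (<⇒≤ (row<n p))) (fromℕ< p)

    filling : CSF lam
    filling = record
      { entry  = λ u → fromℕ< (value-<n u)
      ; strict = λ { u@(cell r c p) v@(cell s .c q) refl r<s →
          subst₂ _<_ (sym (Fin.toℕ-fromℕ< (value-<n u))) (sym (Fin.toℕ-fromℕ< (value-<n v)))
            (value-strict r s c p q r<s) }
      }

    private
      rowOf-filling : ∀ i .(i≤n : i ≤ n) k → rowOf filling i k ≡ values (rowAt i i≤n) k
      rowOf-filling i i≤n k = trans (Fin.toℕ-fromℕ< (value-<n (rowCell lam i k)))
        (cong (values (rowAt i i≤n)) (Fin.fromℕ<-toℕ k _))

    ψ-inv-filling : ψ-inv filling ≈ᴾ P
    ψ-inv-filling = (λ i j i≤j j<n → begin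
        #≤ filling i j                  ≡⟨ #≤-rowOf filling i j ⟩
        #≤ᶠ (rowOf filling i) j         ≡⟨ #≤ᶠ-cong j (rowOf-filling i (<⇒≤ (≤-<-trans i≤j j<n))) ⟩
        #≤ᶠ (values (rowAt i _)) j      ≡⟨ counts (rowAt i (<⇒≤ (≤-<-trans i≤j j<n))) j i≤j j<n ⟩
        T i j i≤j j<n                   ∎)
      , λ i j i≤j 1+j<n → let i<n = ≤-<-trans i≤j (<-trans (n<1+n j) 1+j<n) in begin
        map (zcountʳ filling) (cellsWith filling i j)
          ≡⟨ overlay-rowCode filling i j ⟩
        rowCode (suc j) (rowOf filling i) (belowOf filling i)
          ≡⟨ rowCode-cong (suc j) (rowOf-filling i (<⇒≤ i<n)) (extend-cong n (rowOf-filling (suc i) i<n)) ⟩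
        rowCode (suc j) (values (rowAt i (<⇒≤ i<n))) (extend n (values (rowAt (suc i) i<n)))
          ≡⟨ codes (rowAt-above i i<n) j i≤j 1+j<n ⟩
        overlay P i j i≤j 1+j<n ∎
      where open ≡-Reasoning

-- The statistics as sums of zcounts.

-- Inclusion-exclusion, with conjunction and disjunction given up to equivalence.
𝟙-×-⊎ : {P Q R S : Set} (p? : Dec P) (q? : Dec Q) (r? : Dec R) (s? : Dec S) →
        (P × Q → R) → (R → P × Q) → (P ⊎ Q → S) → (S → P ⊎ Q) → 𝟙 p? + 𝟙 q? ≡ 𝟙 r? + 𝟙 s?
𝟙-×-⊎ (yes p) (yes q) r? s? r r⁻ s s⁻ = sym (cong₂ _+_ (𝟙-yes r? (r (p , q))) (𝟙-yes s? (s (inj₁ p))))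
𝟙-×-⊎ (yes p) (no ¬q) r? s? r r⁻ s s⁻ = sym (cong₂ _+_ (𝟙-no r? (¬q ∘ proj₂ ∘ r⁻)) (𝟙-yes s? (s (inj₁ p))))
𝟙-×-⊎ (no ¬p) (yes q) r? s? r r⁻ s s⁻ = sym (cong₂ _+_ (𝟙-no r? (¬p ∘ proj₁ ∘ r⁻)) (𝟙-yes s? (s (inj₂ q))))
𝟙-×-⊎ (no ¬p) (no ¬q) r? s? r r⁻ s s⁻ =
  sym (cong₂ _+_ (𝟙-no r? (¬p ∘ proj₁ ∘ r⁻)) (𝟙-no s? ([ ¬p , ¬q ] ∘ s⁻)))

module _ {n : ℕ} {lam : Partition n} where

  ∑-rowCells-cong : ∀ r {g h : Cell lam → ℕ} → (∀ k → g (rowCell lam r k) ≡ h (rowCell lam r k)) →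
                    ∑ (rowCells lam r) g ≡ ∑ (rowCells lam r) h
  ∑-rowCells-cong r {g} {h} e =
    trans (∑-tabulate (rowCell lam r) g) (trans (∑ᶠ-cong e) (sym (∑-tabulate (rowCell lam r) h)))

  ∑-rowCells-0 : ∀ r {g : Cell lam → ℕ} → (∀ k → g (rowCell lam r k) ≡ 0) → ∑ (rowCells lam r) g ≡ 0
  ∑-rowCells-0 r {g} e = trans (∑-tabulate (rowCell lam r) g) (∑ᶠ-0 e)

  ∑-cells : (g : Cell lam → ℕ) → ∑ (cells lam) g ≡ ∑ (upTo n) (λ i → ∑ (rowCells lam i) g)
  ∑-cells g = ∑-concatMap (rowCells lam) (upTo n) g

  ∑-cells-row : ∀ r {P : Cell lam → Set} (P? : Decidable P) →
                ∑ (cells lam) (λ u → 𝟙 (row u ≟ r ×-dec P? u)) ≡ ∑ (rowCells lam r) (𝟙 ∘ P?)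
  ∑-cells-row r P? = begin
    ∑ (cells lam) g                            ≡⟨ ∑-cells g ⟩
    ∑ (upTo n) (λ i → ∑ (rowCells lam i) g)
      ≡⟨ ∑-upTo-select n r (λ i → ∑ (rowCells lam i) g)
           (λ i i≢r → ∑-rowCells-0 i λ k → 𝟙-no (i ≟ r ×-dec P? (rowCell lam i k)) (i≢r ∘ proj₁))
           (λ n≤r → ∑-rowCells-0 r λ k → contradiction k (¬row≥n {lam = lam} n≤r)) ⟩
    ∑ (rowCells lam r) g
      ≡⟨ ∑-rowCells-cong r (λ k → 𝟙-cong (r ≟ r ×-dec P? (rowCell lam r k)) (P? (rowCell lam r k))
           proj₂ (refl ,_)) ⟩
    ∑ (rowCells lam r) (𝟙 ∘ P?)                ∎
    where
    open ≡-Reasoning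
    g = λ u → 𝟙 (row u ≟ r ×-dec P? u)

  below-property : (F : CSF lam) → ∀ x →
                   Maybe.All (λ y → col y ≡ col x × entry F x Fin.< entry F y) (below x)
  below-property F (cell r c p) with c <? part lam (suc r)
  ... | yes q = Maybe.just (refl , strict F _ _ refl (n<1+n r))
  ... | no _  = Maybe.nothing

  module _ (F : CSF lam) where

    private
      f = entry F

    ∑-Des : (g : Cell lam → ℕ) → ∑ (Des F) g ≡ ∑ (upTo n) (λ i → ∑ (rowCells lam (suc i)) g)
    ∑-Des g = begin
      ∑ (Des F) g                     ≡⟨ ∑-filter desc? (cells lam) g ⟩
      ∑ (cells lam) h                 ≡⟨ ∑-cells h ⟩
      -- The empty row `n` is appended so that the first row, which has no descents, can be shifted
      -- out.
      ∑ (upTo n) D                    ≡⟨ +-identityʳ _ ⟨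
      ∑ (upTo n) D + 0                ≡⟨ cong (∑ (upTo n) D +_) (∑-rowCells-0 n λ k →
                                           contradiction k (¬row≥n {lam = lam} ≤-refl)) ⟨
      ∑ (upTo n) D + D n              ≡⟨ ∑-upTo-shift n D ⟨
      D 0 + ∑ (upTo n) (D ∘ suc)      ≡⟨ cong₂ _+_ (∑-rowCells-0 0 λ _ → refl) (∑-cong (upTo n) λ i →
                                           ∑-rowCells-cong (suc i) λ k → trans
                                             (cong (_* g (rowCell lam (suc i) k))
                                               (𝟙-yes (desc? (rowCell lam (suc i) k))
                                                 (MaybeAny.just (strict F _ _ refl (n<1+n i)))))
                                             (*-identityˡ (g (rowCell lam (suc i) k)))) ⟩
      ∑ (upTo n) (λ i → ∑ (rowCells lam (suc i)) g) ∎
      where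
      open ≡-Reasoning
      desc? = λ u → MaybeAny.dec (λ v → f v Fin.<? f u) (up u)
      h = λ u → 𝟙 (desc? u) * g u
      D = λ i → ∑ (rowCells lam i) h

    -- R is < for inv and > for quinv.
    module _ {R : ℕ → ℕ → Set} (R? : Decidable₂ R) where

      private
        S? : (u v : Cell lam) → Dec (R (col u) (col v))
        S? u v = R? (col u) (col v)

      attacks? : ∀ u v → Dec ((row u ≡ row v × R (col u) (col v))
                            ⊎ (row u ≡ suc (row v) × R (col v) (col u)))
      attacks? u v = (row u ≟ row v ×-dec S? u v) ⊎-dec (row u ≟ suc (row v) ×-dec S? v u)

      #attacks : ℕ
      #attacks = length (filter (λ (u , v) → attacks? u v ×-dec f v Fin.<? f u)
                                (cartesianProduct (cells lam) (cells lam)))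

      zcount : Cell lam → ℕ
      zcount c = length (filter (λ x → S? c x ×-dec between? F c x) (rowCells lam (row c)))

      -- Counts the two-row attacks on `c` before entries are compared; its total will be the arm
      -- sum that the statistic subtracts.
      belows : Cell lam → ℕ
      belows c = ∑ (rowCells lam (suc (row c))) (λ y → 𝟙 (S? c y))

      private
        left? : ∀ c x → Dec (R (col c) (col x) × f x Fin.< f c)
        left? c x = S? c x ×-dec f x Fin.<? f c

        right? : ∀ c y → Dec (R (col c) (col y) × f c Fin.< f y)
        right? c y = S? c y ×-dec f c Fin.<? f y

        all? : ∀ c m → Dec (Maybe.All (λ y → f c Fin.< f y) m)
        all? c = Maybe.dec (λ y → f c Fin.<? f y)

        -- At least one of x < c and c < y holds when x < y.
        triple : ∀ c x m → Maybe.All (λ y → col y ≡ col x × f x Fin.< f y) m →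
                 𝟙 (left? c x) + maybe′ (𝟙 ∘ right? c) 0 m
                 ≡ 𝟙 (S? c x ×-dec (f x Fin.<? f c ×-dec all? c m)) + maybe′ (𝟙 ∘ S? c) 0 m
        triple c x nothing Maybe.nothing = cong (_+ 0)
          (𝟙-cong (left? c x) (S? c x ×-dec (f x Fin.<? f c ×-dec all? c nothing))
            (λ (s , l) → s , l , Maybe.nothing) (λ (s , l , _) → s , l))
        triple c x (just y) (Maybe.just (eq , x<y)) =
          𝟙-×-⊎ (left? c x) (right? c y) (S? c x ×-dec (f x Fin.<? f c ×-dec all? c (just y))) (S? c y)
            (λ ((s , l) , (_ , r)) → s , l , Maybe.just r)
            (λ { (s , l , Maybe.just r) → (s , l) , (subst (R (col c)) (sym eq) s , r) })
            [ (λ (s , _) → subst (R (col c)) (sym eq) s) , proj₁ ]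
            (λ s → split s (≤-<-connex (toℕ (f y)) (toℕ (f c))))
          where
          split : R (col c) (col y) → f y Fin.≤ f c ⊎ f c Fin.< f y →
                  (R (col c) (col x) × f x Fin.< f c) ⊎ (R (col c) (col y) × f c Fin.< f y)
          split s (inj₁ y≤c) = inj₁ (subst (R (col c)) eq s , <-≤-trans x<y y≤c)
          split s (inj₂ c<y) = inj₂ (s , c<y)

        triples : ∀ c → ∑ (rowCells lam (row c)) (𝟙 ∘ left? c)
                        + ∑ (rowCells lam (suc (row c))) (𝟙 ∘ right? c)
                        ≡ zcount c + belows c
        triples c = begin
          ∑ xs (𝟙 ∘ left? c) + ∑ ys (𝟙 ∘ right? c)
            ≡⟨ cong (∑ xs (𝟙 ∘ left? c) +_) (∑-rowCells-below (row c) (𝟙 ∘ right? c)) ⟨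
          ∑ xs (𝟙 ∘ left? c) + ∑ xs (maybe′ (𝟙 ∘ right? c) 0 ∘ below)
            ≡⟨ ∑-+ xs _ _ ⟨
          ∑ xs (λ x → 𝟙 (left? c x) + maybe′ (𝟙 ∘ right? c) 0 (below x))
            ≡⟨ ∑-cong xs (λ x → triple c x (below x) (below-property F x)) ⟩
          ∑ xs (λ x → 𝟙 (S? c x ×-dec between? F c x) + maybe′ (𝟙 ∘ S? c) 0 (below x))
            ≡⟨ ∑-+ xs _ _ ⟩
          ∑ xs (λ x → 𝟙 (S? c x ×-dec between? F c x)) + ∑ xs (maybe′ (𝟙 ∘ S? c) 0 ∘ below)
            ≡⟨ cong₂ _+_ (sym (length-filter-∑ (λ x → S? c x ×-dec between? F c x) xs))
                         (∑-rowCells-below (row c) (𝟙 ∘ S? c)) ⟩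
          zcount c + belows c ∎
          where
          open ≡-Reasoning
          xs = rowCells lam (row c)
          ys = rowCells lam (suc (row c))

      #attacks≡ : #attacks ≡ ∑ (cells lam) zcount + ∑ (cells lam) belows
      #attacks≡ = begin
        #attacks
          ≡⟨ length-filter-∑ (λ (u , v) → attacks? u v ×-dec f v Fin.<? f u) (cartesianProduct cs cs) ⟩
        ∑ (cartesianProduct cs cs) (λ (u , v) → 𝟙 (attacks? u v ×-dec f v Fin.<? f u))
          ≡⟨ ∑-cartesianProduct cs cs _ ⟩
        ∑ cs (λ u → ∑ cs (λ v → 𝟙 (attacks? u v ×-dec f v Fin.<? f u)))
          ≡⟨ ∑-cong cs (λ u → trans (∑-cong cs (λ v → sym (two-kinds u v))) (∑-+ cs _ _)) ⟩
        ∑ cs (λ u → ∑ cs (λ v → 𝟙 (row v ≟ row u ×-dec left? u v))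
                  + ∑ cs (λ v → 𝟙 (row u ≟ suc (row v) ×-dec right? v u)))
          ≡⟨ ∑-+ cs _ _ ⟩
        ∑ cs (λ u → ∑ cs (λ v → 𝟙 (row v ≟ row u ×-dec left? u v)))
        + ∑ cs (λ u → ∑ cs (λ v → 𝟙 (row u ≟ suc (row v) ×-dec right? v u)))
          -- A same-row pair is charged to its attacker and a two-row pair to its target, these
          -- being the roles of `c` in a triple; hence the swap in the second sum.
          ≡⟨ cong (∑ cs (λ u → ∑ cs (λ v → 𝟙 (row v ≟ row u ×-dec left? u v))) +_)
               (∑-swap cs cs (λ u v → 𝟙 (row u ≟ suc (row v) ×-dec right? v u))) ⟩
        ∑ cs (λ c → ∑ cs (λ v → 𝟙 (row v ≟ row c ×-dec left? c v)))
        + ∑ cs (λ c → ∑ cs (λ u → 𝟙 (row u ≟ suc (row c) ×-dec right? c u)))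
          ≡⟨ cong₂ _+_ (∑-cong cs λ c → ∑-cells-row (row c) (left? c))
                       (∑-cong cs λ c → ∑-cells-row (suc (row c)) (right? c)) ⟩
        ∑ cs (λ c → ∑ (rowCells lam (row c)) (𝟙 ∘ left? c))
        + ∑ cs (λ c → ∑ (rowCells lam (suc (row c))) (𝟙 ∘ right? c))
          ≡⟨ ∑-+ cs _ _ ⟨
        ∑ cs (λ c → ∑ (rowCells lam (row c)) (𝟙 ∘ left? c) + ∑ (rowCells lam (suc (row c))) (𝟙 ∘ right? c))
          ≡⟨ ∑-cong cs triples ⟩
        ∑ cs (λ c → zcount c + belows c)
          ≡⟨ ∑-+ cs _ _ ⟩
        ∑ cs zcount + ∑ cs belows ∎
        where
        open ≡-Reasoning
        cs = cells lam
        two-kinds : ∀ u v → 𝟙 (row v ≟ row u ×-dec left? u v) + 𝟙 (row u ≟ suc (row v) ×-dec right? v u)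
                            ≡ 𝟙 (attacks? u v ×-dec f v Fin.<? f u)
        two-kinds u v = 𝟙-⊎ (row v ≟ row u ×-dec left? u v) (row u ≟ suc (row v) ×-dec right? v u)
          (attacks? u v ×-dec f v Fin.<? f u)
          (λ (e , s , l) → inj₁ (sym e , s) , l)
          (λ (e , s , l) → inj₂ (e , s) , l)
          (λ { (inj₁ (e , s) , l) → inj₁ (sym e , s , l) ; (inj₂ (e , s) , l) → inj₂ (e , s , l) })
          (λ (e , _) (e′ , _) → 1+n≢n (sym (trans e e′)))

      -- By `entry-≥` such a cell holds the least entry of its row. These are the cells that no
      -- overlay records.
      zcount-0 : ∀ c → toℕ (f c) ≤ row c → zcount c ≡ 0
      zcount-0 c fc≤ = trans (length-filter-∑ (λ x → S? c x ×-dec between? F c x) (rowCells lam (row c)))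
        (∑-rowCells-0 (row c) λ k → 𝟙-no
          (S? c (rowCell lam (row c) k) ×-dec between? F c (rowCell lam (row c) k))
          λ (_ , fx<fc , _) → <⇒≱ fx<fc (≤-trans fc≤ (entry-≥ F (rowCell lam (row c) k))))

      attacks-statistic : ∀ g →
        (∀ i → ∑ (rowCells lam (suc i)) g ≡ ∑ (rowCells lam i) belows) →
        #attacks ⊖ ∑ (Des F) g ≡ ℤ.+ ∑ (cells lam) zcount
      attacks-statistic g h = begin
        #attacks ⊖ ∑ (Des F) g  ≡⟨ cong₂ _⊖_ #attacks≡ des ⟩
        (Z + B) ⊖ B             ≡⟨ ⊖-≥ (m≤n+m B Z) ⟩
        ℤ.+ (Z + B ∸ B)           ≡⟨ cong ℤ.+_ (m+n∸n≡m Z B) ⟩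
        ℤ.+ Z                     ∎
        where
        open ≡-Reasoning
        Z = ∑ (cells lam) zcount
        B = ∑ (cells lam) belows
        des : ∑ (Des F) g ≡ B
        des = trans (∑-Des g) (trans (∑-cong (upTo n) h) (sym (∑-cells belows)))

    inv≡ : inv F ≡ ℤ.+ ∑ (cells lam) (zcountʳ F)
    inv≡ = attacks-statistic _<?_ arm λ i → begin
      ∑ (rowCells lam (suc i)) arm                 ≡⟨ ∑-rowCells-below {lam = lam} i arm ⟨
      ∑ (rowCells lam i) (maybe′ arm 0 ∘ below)    ≡⟨ ∑-rowCells-cong i (arm-below i) ⟩
      ∑ (rowCells lam i) (belows _<?_)             ∎
      where
      open ≡-Reasoning
      -- With no cell beneath, the next row ends at or before this column and both sides vanish.
      arm-below : ∀ i k → maybe′ arm 0 (below (rowCell lam i k)) ≡ belows _<?_ (rowCell lam i k)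
      arm-below i k with toℕ k <? part lam (suc i)
      ... | yes p = length-filter-∑ (λ x → toℕ k <? col x) (rowCells lam (suc i))
      ... | no ¬p = sym (∑-rowCells-0 (suc i) λ l →
        𝟙-no (toℕ k <? toℕ l) (≤⇒≯ (≤-trans (<⇒≤ (Fin.toℕ<n l)) (≮⇒≥ ¬p))))

    quinv≡ : quinv F ≡ ℤ.+ ∑ (cells lam) (zcountˡ F)
    quinv≡ = attacks-statistic _>?_ (maybe′ arm 0 ∘ up) λ i → begin
      ∑ (rowCells lam (suc i)) (maybe′ arm 0 ∘ up)
        ≡⟨ ∑-rowCells-cong (suc i) (λ k → length-filter-∑ (λ x → toℕ k <? col x) (rowCells lam i)) ⟩
      ∑ (rowCells lam (suc i)) (λ u → ∑ (rowCells lam i) (λ c → 𝟙 (col u <? col c)))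
        -- Double counting of pairs formed by a cell of the lower row and a cell of the upper row
        -- strictly to its right.
        ≡⟨ ∑-swap (rowCells lam (suc i)) (rowCells lam i) _ ⟩
      ∑ (rowCells lam i) (λ c → ∑ (rowCells lam (suc i)) (λ u → 𝟙 (col u <? col c)))
        ≡⟨ ∑-rowCells-cong i (λ _ → refl) ⟩
      ∑ (rowCells lam i) (belows _>?_) ∎
      where open ≡-Reasoning

  -- Total sizes of overlays.

  overlaySum : POP lam → ℕ → ℕ → ℕ
  overlaySum P i j with i ≤? j | suc j <? n
  ... | yes i≤j | yes 1+j<n = sum (overlay P i j i≤j 1+j<n)
  ... | _       | _         = 0

  size : POP lam → ℕ
  size P = ∑ (upTo n) λ i → ∑ (upTo n) (overlaySum P i)

  size-cong : {P Q : POP lam} → P ≈ᴾ Q → size P ≡ size Q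
  size-cong {P} {Q} (_ , o) = ∑-cong (upTo n) λ i → ∑-cong (upTo n) (same i)
    where
    same : ∀ i j → overlaySum P i j ≡ overlaySum Q i j
    same i j with i ≤? j | suc j <? n
    ... | yes i≤j | yes 1+j<n = cong sum (o i j i≤j 1+j<n)
    ... | yes _   | no _      = refl
    ... | no _    | _         = refl

  -- Row `i` is grouped by the entry `suc j`. Groups without an overlay add nothing: entries at most
  -- the row index, 0 among them, by the first hypothesis, and entries from `n` on because they do
  -- not occur.
  ∑-cells-size : (F : CSF lam) (z : Cell lam → ℕ) (P : POP lam) →
    (∀ c → toℕ (entry F c) ≤ row c → z c ≡ 0) →
    (∀ i j (i≤j : i ≤ j) (1+j<n : suc j < n) → ∑ (cellsWith F i j) z ≡ sum (overlay P i j i≤j 1+j<n)) →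
    ∑ (cells lam) z ≡ size P
  ∑-cells-size F z P z0 o = trans (∑-cells z) (∑-cong (upTo n) λ i → begin
    ∑ (rowCells lam i) z
      ≡⟨ ∑-rowCells-cong i (λ k → sym (by-value (rowCell lam i k) (toℕ (entry F (rowCell lam i k))) refl)) ⟩
    ∑ (rowCells lam i) (λ c → ∑ (upTo n) (λ j → 𝟙 (toℕ (entry F c) ≟ suc j) * z c))
      ≡⟨ ∑-swap (rowCells lam i) (upTo n) _ ⟩
    ∑ (upTo n) (λ j → ∑ (rowCells lam i) (λ c → 𝟙 (toℕ (entry F c) ≟ suc j) * z c))
      ≡⟨ ∑-cong (upTo n) (per-value i) ⟩
    ∑ (upTo n) (overlaySum P i) ∎)
    where
    open ≡-Reasoning

    by-value : ∀ c a → toℕ (entry F c) ≡ a → ∑ (upTo n) (λ j → 𝟙 (toℕ (entry F c) ≟ suc j) * z c) ≡ z c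
    by-value c zero e = trans (∑-0 (upTo n) λ j → trans (cong (𝟙 (toℕ (entry F c) ≟ suc j) *_) zc)
        (*-zeroʳ (𝟙 (toℕ (entry F c) ≟ suc j)))) (sym zc)
      where zc = z0 c (subst (_≤ row c) (sym e) z≤n)
    by-value c (suc j) e = trans
      (∑-upTo-select n j (λ j → 𝟙 (toℕ (entry F c) ≟ suc j) * z c)
        (λ i i≢j → cong (_* z c) (𝟙-no (toℕ (entry F c) ≟ suc i)
          λ e′ → i≢j (suc-injective (trans (sym e′) e))))
        (λ n≤j → contradiction (Fin.toℕ<n (entry F c))
          (≤⇒≯ (subst (n ≤_) (sym e) (m≤n⇒m≤1+n n≤j)))))
      (trans (cong (_* z c) (𝟙-yes (toℕ (entry F c) ≟ suc j) e)) (*-identityˡ (z c)))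

    vanish : ∀ i j → (∀ k → toℕ (entry F (rowCell lam i k)) ≡ suc j → z (rowCell lam i k) ≡ 0) →
             ∑ (rowCells lam i) (λ c → 𝟙 (toℕ (entry F c) ≟ suc j) * z c) ≡ 0
    vanish i j h = ∑-rowCells-0 i λ k → case k (toℕ (entry F (rowCell lam i k)) ≟ suc j)
      where
      case : ∀ k → (d : Dec (toℕ (entry F (rowCell lam i k)) ≡ suc j)) → 𝟙 d * z (rowCell lam i k) ≡ 0
      case k (yes e) = trans (*-identityˡ (z (rowCell lam i k))) (h k e)
      case k (no _)  = refl

    per-value : ∀ i j → ∑ (rowCells lam i) (λ c → 𝟙 (toℕ (entry F c) ≟ suc j) * z c) ≡ overlaySum P i j
    per-value i j with i ≤? j | suc j <? n
    ... | yes i≤j | yes 1+j<n = trans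
      (sym (∑-filter (λ c → toℕ (entry F c) ≟ suc j) (rowCells lam i) z)) (o i j i≤j 1+j<n)
    ... | yes _   | no 1+j≮n  = vanish i j λ k e →
      contradiction (subst (_< n) e (Fin.toℕ<n (entry F (rowCell lam i k)))) 1+j≮n
    ... | no i≰j  | _         = vanish i j λ k e →
      z0 (rowCell lam i k) (subst (_≤ i) (sym e) (≰⇒> i≰j))

  inv≡size : (F : CSF lam) → inv F ≡ ℤ.+ size (ψ-inv F)
  inv≡size F = trans (inv≡ F) (cong ℤ.+_ (∑-cells-size F (zcountʳ F) (ψ-inv F)
    (zcount-0 F _<?_) (λ _ _ _ _ → refl)))

  quinv≡size : (F : CSF lam) → quinv F ≡ ℤ.+ size (ψ-quinv F)
  quinv≡size F = trans (quinv≡ F) (cong ℤ.+_ (∑-cells-size F (zcountˡ F) (ψ-quinv F)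
    (zcount-0 F _>?_) (λ i j _ _ → sum-↭ (map⁺ (zcountˡ F) (↭-sym (↭-reverse (cellsWith F i j)))))))

corollary5 : (n : ℕ) → n ≥ 1 → (lam : Partition n) →
    Σ[ ψ-inv⁻¹ ∈ (POP lam → CSF lam) ]
      Inverseᵇ _≈_ _≈ᴾ_ ψ-inv ψ-inv⁻¹ ×
      (let Ω : CSF lam → CSF lam
           Ω = ψ-inv⁻¹ ∘ ψ-quinv
       in (∀ F → Ω F ≈ (ψ-inv⁻¹ ∘ boxcomp ∘ ψ-inv) F) ×
          (∀ F → Ω (Ω F) ≈ F) ×
          (∀ F → inv (Ω F) ≡ quinv F) ×
          (∀ F → rsort F ≈ᴳ rsort (Ω F)))
corollary5 n _ lam =
    filling
  , ((λ {P} {F} → ψ-inv≈ {P} {F}) , (λ {F} {P} → filling≈ {F} {P}))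
  , (λ F → filling≈ {filling (boxcomp (ψ-inv F))} (begin
      ψ-quinv F                               ≈⟨ ψ-quinv≈boxcomp F ⟩
      boxcomp (ψ-inv F)                       ≈⟨ ψ-inv-filling (boxcomp (ψ-inv F)) ⟨
      ψ-inv (filling (boxcomp (ψ-inv F)))     ∎))
  , (λ F → filling≈ {F} (begin
      ψ-quinv (Ω F)                 ≈⟨ ψ-quinv≈boxcomp (Ω F) ⟩
      boxcomp (ψ-inv (Ω F))         ≈⟨ boxcomp-cong {P = ψ-inv (Ω F)} {boxcomp (ψ-inv F)}
                                         (ψΩ-boxcomp F) ⟩
      boxcomp (boxcomp (ψ-inv F))   ≈⟨ boxcomp-involutive (ψ-inv F) ⟩
      ψ-inv F                       ∎))
  , (λ F → ≡.begin
      inv (Ω F)                ≡.≡⟨ inv≡size (Ω F) ⟩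
      ℤ.+ size (ψ-inv (Ω F))   ≡.≡⟨ cong ℤ.+_ (size-cong {P = ψ-inv (Ω F)} {ψ-quinv F}
                                      (ψ-inv-filling (ψ-quinv F))) ⟩
      ℤ.+ size (ψ-quinv F)     ≡.≡⟨ quinv≡size F ⟨
      quinv F                  ≡.∎)
  , (λ F i j i≤j j<n → sym (proj₁ (ψ-inv-filling (ψ-quinv F)) i j i≤j j<n))
  where
  open import Relation.Binary.Reasoning.Setoid (≈ᴾ-setoid {lam = lam})
  module ≡ = ≡-Reasoning

  Ω : CSF lam → CSF lam
  Ω F = filling (ψ-quinv F)

  -- Under `ψ-inv` the map `Ω` becomes the box complement, from which it inherits being an
  -- involution.
  ψΩ-boxcomp : ∀ F → ψ-inv (Ω F) ≈ᴾ boxcomp (ψ-inv F)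
  ψΩ-boxcomp F = begin
    ψ-inv (Ω F)        ≈⟨ ψ-inv-filling (ψ-quinv F) ⟩
    ψ-quinv F          ≈⟨ ψ-quinv≈boxcomp F ⟩
    boxcomp (ψ-inv F)  ∎

  ψ-inv≈ : ∀ {P F} → F ≈ filling P → ψ-inv F ≈ᴾ P
  ψ-inv≈ {P} {F} F≈ = begin
    ψ-inv F            ≈⟨ ψ-inv-cong {F = F} {filling P} F≈ ⟩
    ψ-inv (filling P)  ≈⟨ ψ-inv-filling P ⟩
    P                  ∎

  filling≈ : ∀ {F P} → P ≈ᴾ ψ-inv F → filling P ≈ F
  filling≈ {F} {P} P≈ = ψ-inv-injective {F = filling P} {F} (begin
    ψ-inv (filling P)  ≈⟨ ψ-inv-filling P ⟩
    P                  ≈⟨ P≈ ⟩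
    ψ-inv F            ∎)
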